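{- Fix an integer $d\ge 2$. Let $(H_n)$ be a sequence of hypergraphs, where $H_n=\langle V_n,E_n\rangle$ is a $d$-uniform, $k$-regular hypergraph on $n$ vertices with $k=k(n)\to\infty$ as $n\to\infty$, and such that every codegree in $H_n$ is $o(k)$. Then \[M(H_n)\le \left((1+o(1))\frac{k}{e^{d-1}}\right)^{n/d}.\]
   Context: A hypergraph is $d$-uniform if every edge has exactly $d$ vertices, and $k$-regular if every vertex lies in exactly $k$ edges. The codegree of two distinct vertices is the number of edges containing both. A perfect matching is a set of pairwise disjoint edges covering all vertices; $M(H)$ denotes the number of perfect matchings of $H$. The $o(\cdot)$ terms are with respect to $n\to\infty$. -}

module Defs where

open import Data.Nat using (ℕ; zero; suc; _+_; _*_; _∸_; _^_; _≤_; _<_; _!; _≡ᵇ_)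
open import Data.Nat.Properties using (_!≢0)
open import Data.Nat.DivMod using (_/_)
open import Data.Bool using (Bool; true; false; _∧_; T)
open import Data.List using (List; []; _∷_; length; filterᵇ; map; upTo; allFin; _++_)
open import Data.Bool.ListAction using (all; any)
open import Data.Nat.ListAction using (sum)
open import Data.List.Relation.Unary.All using (All)
open import Data.List.Relation.Unary.Unique.Propositional using (Unique)
open import Data.Vec using (Vec; []; _∷_; lookup)
open import Data.Fin using (Fin)
open import Data.Fin.Subset using (Subset; _∩_; ∣_∣)
open import Data.Product using (Σ; ∃; _×_; _,_)
open import Relation.Binary.PropositionalEquality using (_≡_; _≢_)

record Hypergraph (n : ℕ) : Set where
  field
    edges    : List (Subset n)
    distinct : Unique edges
open Hypergraph public

Uniform : ∀ {n} → ℕ → Hypergraph n → Set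
Uniform d H = All (λ e → ∣ e ∣ ≡ d) (edges H)

deg : ∀ {n} → Hypergraph n → Fin n → ℕ
deg H v = length (filterᵇ (λ e → lookup e v) (edges H))

Regular : ∀ {n} → ℕ → Hypergraph n → Set
Regular k H = ∀ v → deg H v ≡ k

codeg : ∀ {n} → Hypergraph n → Fin n → Fin n → ℕ
codeg H u v = length (filterᵇ (λ e → lookup e u ∧ lookup e v) (edges H))

disjointᵇ : ∀ {n} → Subset n → Subset n → Bool
disjointᵇ e f = ∣ e ∩ f ∣ ≡ᵇ 0

pairwiseDisjointᵇ : ∀ {n} → List (Subset n) → Bool
pairwiseDisjointᵇ [] = true
pairwiseDisjointᵇ (e ∷ es) = all (disjointᵇ e) es ∧ pairwiseDisjointᵇ es

coversᵇ : ∀ {n} → List (Subset n) → Bool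
coversᵇ {n} es = all (λ v → any (λ e → lookup e v) es) (allFin n)

isPerfectMatchingᵇ : ∀ {n} → List (Subset n) → Bool
isPerfectMatchingᵇ es = pairwiseDisjointᵇ es ∧ coversᵇ es

allSelections : (m : ℕ) → List (Vec Bool m)
allSelections zero = [] ∷ []
allSelections (suc m) = map (true ∷_) (allSelections m) ++ map (false ∷_) (allSelections m)

select : {A : Set} (xs : List A) → Vec Bool (length xs) → List A
select [] [] = []
select (x ∷ xs) (true ∷ s) = x ∷ select xs s
select (x ∷ xs) (false ∷ s) = select xs s

M : ∀ {n} → Hypergraph n → ℕ
M H = length (filterᵇ (λ s → isPerfectMatchingᵇ (select (edges H) s))
                      (allSelections (length (edges H))))

-- eNum m = Σ_{j=0}^{m} m!/j!  (so eNum m / m! is the m-th partial sum of e = Σ 1/j!)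
eNum : ℕ → ℕ
eNum m = sum (map (λ j → (m ! / j !) {{j !≢0}}) (upTo (suc m)))

-- a/b < e  (e = Σ_j 1/j!), i.e. a/b is below some partial sum of the series
BelowE : ℕ → ℕ → Set
BelowE a b = ∃ λ m → a * m ! < b * eNum m

TendsToInfinity : (ℕ → ℕ) → Set
TendsToInfinity k = ∀ K → ∃ λ N → ∀ n → N ≤ n → K ≤ k n

-- every codegree of H_n is o(k(n)): for every ε = 1/c, eventually all codegrees ≤ ε k(n)
CodegreeLittleO : (H : (n : ℕ) → Hypergraph n) → (ℕ → ℕ) → Set
CodegreeLittleO H k = ∀ c → 1 ≤ c → ∃ λ N → ∀ n → N ≤ n →
  ∀ (u v : Fin n) → u ≢ v → c * codeg (H n) u v ≤ k n

{-# OPTIONS --safe #-}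

-- Let N(s) be the number of edges contained in the union of a matching s, and m = n/d. Remove the
-- edges of a perfect matching s one by one in a random order. Then m! E ∏ 1/N, over the successive
-- remaining matchings, is the probability that choosing uniformly among the available edges yields
-- s, so these numbers sum to at most 1 over all s. An edge that meets t edges of s survives until
-- j edges of s are left with probability at most (j/m)^t, and t = d for all but o(k m) of the k m
-- edges, because codegrees are o(k). Hence E N ≤ k j ((j/m)^(d-1) + o(1)) at that moment, and by
-- convexity M ≤ ∏_{j ≤ m} k ((j/m)^(d-1) + o(1)) = ((1 + o(1)) k / e^(d-1))^m.
module Submission where

open import Defs
open import Data.Bool using (Bool; true; false; _∧_; not; T; T?)
open import Data.Bool.ListAction using (any)
open import Data.Bool.Properties using (T-∧; T-≡)
open import Data.Fin using (Fin; zero; suc; toℕ; inject₁; fromℕ)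
import Data.Fin.Properties as Fin
open import Data.Fin.Subset using (Subset; ∣_∣; _∩_)
open import Data.List as List using (List; []; _∷_; map; length; filterᵇ; allFin; upTo; [_]; _∷ʳ_; _++_)
open import Data.List.Membership.Propositional using (_∈_)
open import Data.List.Membership.Propositional.Properties using (∈-lookup; ∈-allFin; ∈-upTo⁻)
open import Data.List.Properties using (filter-++; length-++; map-∘; map-++; map-cong-local; upTo-∷ʳ)
open import Data.List.Relation.Unary.All as All using (All; []; _∷_)
open import Data.List.Relation.Unary.All.Properties using (all⁺)
open import Data.List.Relation.Unary.Any using (Any; here; there)
open import Data.List.Relation.Unary.Any.Properties using (any⁻)
open import Data.Nat
open import Data.Nat.Divisibility using (m≤n⇒m!∣n!)
open import Data.Nat.DivMod using (_/_; _%_; m≡m%n+[m/n]*n; m%n<n; m/n*n≤m; n/n≡1; *-/-assoc)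
open import Data.Nat.ListAction using (sum)
open import Data.Nat.ListAction.Properties using (sum-++)
open import Data.Nat.Properties
open import Data.Nat.Tactic.RingSolver using (solve-∀)
open import Data.Product using (∃; _×_; _,_; proj₁; proj₂)
open import Data.Sum using (inj₁; inj₂)
open import Data.Vec using (Vec; []; _∷_; lookup; replicate; _[_]≔_)
open import Function using (_∘_)
open import Function.Bundles using (Equivalence; mk⇔)
open import Relation.Binary.PropositionalEquality hiding (J; [_])
open import Relation.Nullary using (Dec; yes; no; does; contradiction)
open import Relation.Nullary.Decidable using (_×-dec_; does-⇔; dec-true)

open import Algebra.Properties.CommutativeSemigroup *-commutativeSemigroup using (x∙yz≈y∙xz)
open import Algebra.Properties.Semiring.Sum +-*-semiring
  using (∑-comm; ∑-distrib-+; *-distribˡ-sum; *-distribʳ-sum)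
  renaming (sum to ∑; sum-cong-≗ to ∑-cong)
open import Algebra.Properties.CommutativeMonoid.Sum *-1-commutativeMonoid
  using ()
  renaming (sum to ∏; sum-cong-≗ to ∏-cong; ∑-distrib-+ to ∏-distrib-*; ∑-comm to ∏-comm;
            sum-init-last to ∏-init-last)

-- No random order and no logarithm appears. The estimate for the stages still to come, given that
-- exactly `s` is left, is a function `p r s j` of `s` alone, and, suitably scaled, its average over
-- the next removal does not increase. So convexity is used one removal at a time, and gives N ·
-- w(s) ≤ Σ w(s - i), over the members i of s, for the weight w = 1/P. This can be summed over
-- matchings because N depends only on the covered vertex set U: the removed edge runs over the N
-- edges inside U, and induction bounds the total weight by the weight of the empty matching. All of
-- it takes place in the natural numbers: reciprocals are cleared by one common multiple Δ, roots by
-- raising to powers, and e enters only through inequalities a j^j ≤ b (j+1)^j. The o(1) error has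
-- to fit into a product over j as well, which is why it is turned into a shift of j.

-- Finite sums, products and powers

∑-mono : ∀ {n} {f g : Fin n → ℕ} → (∀ i → f i ≤ g i) → ∑ f ≤ ∑ g
∑-mono {zero}  h = z≤n
∑-mono {suc n} h = +-mono-≤ (h zero) (∑-mono (h ∘ suc))

∑-const : ∀ n c → ∑ {n} (λ _ → c) ≡ n * c
∑-const zero    c = refl
∑-const (suc n) c = cong (c +_) (∑-const n c)

term≤∑ : ∀ {n} (f : Fin n → ℕ) i → f i ≤ ∑ f
term≤∑ f zero    = m≤m+n _ _
term≤∑ f (suc i) = ≤-trans (term≤∑ (f ∘ suc) i) (m≤n+m _ _)

∏-mono : ∀ {n} {f g : Fin n → ℕ} → (∀ i → f i ≤ g i) → ∏ f ≤ ∏ g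
∏-mono {zero}  h = ≤-refl
∏-mono {suc n} h = *-mono-≤ (h zero) (∏-mono (h ∘ suc))

∏-const : ∀ n c → ∏ {n} (λ _ → c) ≡ c ^ n
∏-const zero    c = refl
∏-const (suc n) c = cong (c *_) (∏-const n c)

^-distribʳ-* : ∀ k m n → (m * n) ^ k ≡ m ^ k * n ^ k
^-distribʳ-* zero    m n = refl
^-distribʳ-* (suc k) m n = trans (cong (m * n *_) (^-distribʳ-* k m n)) (swap m n (m ^ k) (n ^ k))
  where
  swap : ∀ a b c d → a * b * (c * d) ≡ a * c * (b * d)
  swap = solve-∀

∏-^ : ∀ {n} (f : Fin n → ℕ) k → ∏ f ^ k ≡ ∏ (λ i → f i ^ k)
∏-^ {zero}  f k = ^-zeroˡ k
∏-^ {suc n} f k = trans (^-distribʳ-* k (f zero) _) (cong (f zero ^ k *_) (∏-^ (f ∘ suc) k))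

∏-scale : ∀ {n} c (f : Fin n → ℕ) → ∏ (λ i → c * f i) ≡ c ^ n * ∏ f
∏-scale {n} c f = trans (∏-distrib-* (λ _ → c) f) (cong (_* ∏ f) (∏-const n c))

^-cancelˡ-≤ : ∀ r .{{_ : NonZero r}} {a b} → a ^ r ≤ b ^ r → a ≤ b
^-cancelˡ-≤ r h = ≮⇒≥ λ b<a → <⇒≱ (^-monoˡ-< r b<a) h

-- Bernoulli, AM-GM and Jensen in the natural numbers

2ab≤a²+b² : ∀ a b → 2 * (a * b) ≤ a * a + b * b
2ab≤a²+b² a b with ≤-total a b
... | inj₁ a≤b = subst (λ b → 2 * (a * b) ≤ a * a + b * b) (m+[n∸m]≡n a≤b) (go a (b ∸ a))
  where
  go : ∀ a d → 2 * (a * (a + d)) ≤ a * a + (a + d) * (a + d)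
  go a d = subst (2 * (a * (a + d)) ≤_) (eq a d) (m≤m+n _ (d * d))
    where
    eq : ∀ a d → 2 * (a * (a + d)) + d * d ≡ a * a + (a + d) * (a + d)
    eq = solve-∀
... | inj₂ b≤a = subst (λ a → 2 * (a * b) ≤ a * a + b * b) (m+[n∸m]≡n b≤a) (go b (a ∸ b))
  where
  go : ∀ b d → 2 * ((b + d) * b) ≤ (b + d) * (b + d) + b * b
  go b d = subst (2 * ((b + d) * b) ≤_) (eq b d) (m≤m+n _ (d * d))
    where
    eq : ∀ b d → 2 * ((b + d) * b) + d * d ≡ (b + d) * (b + d) + b * b
    eq = solve-∀

-- With x = a/b this is x^(r+1) ≥ 1 + (r+1)(x - 1), cleared of denominators and of subtraction.
bernoulli : ∀ r a b → suc r * (a * b ^ r) ≤ a ^ suc r + r * b ^ suc r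
bernoulli zero    a b = ≤-reflexive (eq a)
  where
  eq : ∀ a → 1 * (a * 1) ≡ a * 1 + 0
  eq = solve-∀
-- Adding r a b^(r+1) to both sides makes the left one a multiple of 2ab; the same term comes back
-- on the right from a times the induction hypothesis.
bernoulli (suc r) a b = +-cancelˡ-≤ (r * (a * (b * b ^ r))) _ _ (begin
  r * (a * (b * b ^ r)) + suc (suc r) * (a * (b * b ^ r))
    ≡⟨ eq₁ r a b (b ^ r) ⟩
  suc r * b ^ r * (2 * (a * b))
    ≤⟨ *-monoʳ-≤ (suc r * b ^ r) (2ab≤a²+b² a b) ⟩
  suc r * b ^ r * (a * a + b * b)
    ≡⟨ eq₂ r a b (b ^ r) ⟩
  a * (suc r * (a * b ^ r)) + suc r * (b * (b * b ^ r))
    ≤⟨ +-monoˡ-≤ _ (*-monoʳ-≤ a (bernoulli r a b)) ⟩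
  a * (a * a ^ r + r * (b * b ^ r)) + suc r * (b * (b * b ^ r))
    ≡⟨ eq₃ r a b (a ^ r) (b ^ r) ⟩
  r * (a * (b * b ^ r)) + (a * (a * a ^ r) + suc r * (b * (b * b ^ r))) ∎)
  where
  open ≤-Reasoning
  eq₁ : ∀ r a b c → r * (a * (b * c)) + suc (suc r) * (a * (b * c)) ≡ suc r * c * (2 * (a * b))
  eq₁ = solve-∀
  eq₂ : ∀ r a b c → suc r * c * (a * a + b * b) ≡ a * (suc r * (a * c)) + suc r * (b * (b * c))
  eq₂ = solve-∀
  eq₃ : ∀ r a b c e → a * (a * c + r * (b * e)) + suc r * (b * (b * e))
                    ≡ r * (a * (b * e)) + (a * (a * c) + suc r * (b * (b * e)))
  eq₃ = solve-∀

-- Bernoulli's inequality at a = r (y + z) and b = (r + 1) z.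
weighted-amgm₂ : ∀ r y z → suc r ^ suc r * (y * z ^ r) ≤ r ^ r * (y + z) ^ suc r
weighted-amgm₂ zero y z = subst₂ _≤_ (eq₁ y) (eq₂ y z) (m≤m+n y z)
  where
  eq₁ : ∀ y → y ≡ 1 * (y * 1)
  eq₁ = solve-∀
  eq₂ : ∀ y z → y + z ≡ 1 * ((y + z) * 1)
  eq₂ = solve-∀
weighted-amgm₂ r@(suc _) y z = *-cancelˡ-≤ r (+-cancelʳ-≤ (r * b ^ suc r) _ _ (begin
  r * (suc r ^ suc r * (y * z ^ r)) + r * (suc r * z * b ^ r)
    ≡⟨ cong (λ w → r * (suc r ^ suc r * (y * z ^ r)) + r * (suc r * z * w)) (^-distribʳ-* r (suc r) z) ⟩
  r * (suc r * suc r ^ r * (y * z ^ r)) + r * (suc r * z * (suc r ^ r * z ^ r))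
    ≡⟨ eq₁ r y z (suc r ^ r) (z ^ r) ⟩
  suc r * (a * (suc r ^ r * z ^ r))
    ≡⟨ cong (λ w → suc r * (a * w)) (^-distribʳ-* r (suc r) z) ⟨
  suc r * (a * b ^ r)
    ≤⟨ bernoulli r a b ⟩
  a ^ suc r + r * b ^ suc r
    ≡⟨ cong (_+ r * b ^ suc r) (trans (^-distribʳ-* (suc r) r (y + z)) (*-assoc r (r ^ r) _)) ⟩
  r * (r ^ r * (y + z) ^ suc r) + r * b ^ suc r ∎))
  where
  open ≤-Reasoning
  a = r * (y + z)
  b = suc r * z
  eq₁ : ∀ r y z c e → r * (suc r * c * (y * e)) + r * (suc r * z * (c * e)) ≡ suc r * (r * (y + z) * (c * e))
  eq₁ = solve-∀

ι : Bool → ℕ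
ι true  = 1
ι false = 0

ι≤1 : ∀ b → ι b ≤ 1
ι≤1 true  = ≤-refl
ι≤1 false = z≤n

size : ∀ {L} → Vec Bool L → ℕ
size s = ∑ λ i → ι (lookup s i)

∏-const-∈ : ∀ {L} (s : Vec Bool L) c → ∏ (λ i → c ^ ι (lookup s i)) ≡ c ^ size s
∏-const-∈ []          c = refl
∏-const-∈ (true ∷ s)  c = cong₂ _*_ (*-identityʳ c) (∏-const-∈ s c)
∏-const-∈ (false ∷ s) c = trans (+-identityʳ _) (∏-const-∈ s c)

-- Membership is an exponent on one side and a factor on the other, so that `s` is never reindexed;
-- each new member is the y of `weighted-amgm₂`, with z the sum over the others. `jensen` takes r-th
-- powers and then uses this once for the Q_i and once for each column (y_ij)_i.
amgm : ∀ {L} (s : Vec Bool L) (a : Fin L → ℕ) →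
       size s ^ size s * ∏ (λ i → a i ^ ι (lookup s i)) ≤ (∑ λ i → ι (lookup s i) * a i) ^ size s
amgm []          a = ≤-refl
amgm (false ∷ s) a = subst (λ p → size s ^ size s * p ≤ (∑ λ i → ι (lookup s i) * a (suc i)) ^ size s)
                           (sym (+-identityʳ _)) (amgm s (a ∘ suc))
amgm (true ∷ s)  a = *-cancelˡ-≤ (r ^ r) {{self^self r}} (begin
  r ^ r * (suc r ^ suc r * (a zero ^ 1 * p))
    ≡⟨ eq (r ^ r) (suc r ^ suc r) (a zero) p ⟩
  suc r ^ suc r * (a zero * (r ^ r * p))
    ≤⟨ *-monoʳ-≤ (suc r ^ suc r) (*-monoʳ-≤ (a zero) (amgm s (a ∘ suc))) ⟩
  suc r ^ suc r * (a zero * z ^ r)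
    ≤⟨ weighted-amgm₂ r (a zero) z ⟩
  r ^ r * (a zero + z) ^ suc r
    ≡⟨ cong (λ y → r ^ r * (y + z) ^ suc r) (+-identityʳ (a zero)) ⟨
  r ^ r * (a zero + 0 + z) ^ suc r ∎)
  where
  open ≤-Reasoning
  r = size s
  p = ∏ (λ i → a (suc i) ^ ι (lookup s i))
  z = ∑ (λ i → ι (lookup s i) * a (suc i))
  -- The last member leaves r = 0, where `0 ^ 0` is 1, so cancelling r^r is sound there too.
  self^self : ∀ r → NonZero (r ^ r)
  self^self zero      = _
  self^self r@(suc _) = m^n≢0 r r
  eq : ∀ x y a p → x * (y * (a * 1 * p)) ≡ y * (a * (x * p))
  eq = solve-∀

-- Jensen's inequality for the convex function (y_j)_j ↦ ∏_j 1/y_j, with Q_i = D / ∏_j y_ij over a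
-- common denominator D.
jensen : ∀ {L t} (s : Vec Bool L) .{{_ : NonZero (size s)}}
         (y : Fin L → Fin t → ℕ) (q : Fin t → ℕ) (Q : Fin L → ℕ) (D : ℕ) →
         (∀ i → lookup s i ≡ true → Q i * ∏ (y i) ≡ D) →
         (∀ j → ∑ (λ i → ι (lookup s i) * y i j) ≤ size s * q j) →
         size s * D ≤ ∏ q * ∑ (λ i → ι (lookup s i) * Q i)
jensen {L} {t} s y q Q D Qy≡D Σy≤rq = ^-cancelˡ-≤ r (begin
  (r * D) ^ r
    ≡⟨ ^-distribʳ-* r r D ⟩
  r ^ r * D ^ r
    ≡⟨ cong (r ^ r *_) (trans (sym (∏-const-∈ s D)) (trans (∏-cong D^≡) (∏-distrib-* (λ i → Q i ^ w i) (λ i → ∏ λ j → y i j ^ w i)))) ⟩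
  r ^ r * (∏ (λ i → Q i ^ w i) * ∏ (λ i → ∏ λ j → y i j ^ w i))
    ≡⟨ *-assoc (r ^ r) _ _ ⟨
  r ^ r * ∏ (λ i → Q i ^ w i) * ∏ (λ i → ∏ λ j → y i j ^ w i)
    ≡⟨ cong (r ^ r * ∏ (λ i → Q i ^ w i) *_) (∏-comm (λ i j → y i j ^ w i)) ⟩
  r ^ r * ∏ (λ i → Q i ^ w i) * ∏ (λ j → ∏ λ i → y i j ^ w i)
    ≤⟨ *-mono-≤ (amgm s Q) (∏-mono column) ⟩
  (∑ (λ i → w i * Q i)) ^ r * ∏ (λ j → q j ^ r)
    ≡⟨ cong ((∑ (λ i → w i * Q i)) ^ r *_) (∏-^ q r) ⟨
  (∑ (λ i → w i * Q i)) ^ r * ∏ q ^ r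
    ≡⟨ ^-distribʳ-* r (∑ (λ i → w i * Q i)) (∏ q) ⟨
  (∑ (λ i → w i * Q i) * ∏ q) ^ r
    ≡⟨ cong (_^ r) (*-comm (∑ (λ i → w i * Q i)) (∏ q)) ⟩
  (∏ q * ∑ (λ i → w i * Q i)) ^ r ∎)
  where
  open ≤-Reasoning
  r = size s
  w : Fin L → ℕ
  w i = ι (lookup s i)
  D^≡ : ∀ i → D ^ w i ≡ Q i ^ w i * ∏ (λ j → y i j ^ w i)
  D^≡ i with lookup s i in eq
  ... | true  = trans (*-identityʳ D) (trans (sym (Qy≡D i eq))
                  (cong₂ _*_ (sym (*-identityʳ (Q i))) (∏-cong λ j → sym (*-identityʳ (y i j)))))
  ... | false = sym (trans (+-identityʳ _) (trans (∏-const t 1) (^-zeroˡ t)))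
  column : ∀ j → ∏ (λ i → y i j ^ w i) ≤ q j ^ r
  column j = *-cancelˡ-≤ (r ^ r) {{m^n≢0 r r}} (begin
    r ^ r * ∏ (λ i → y i j ^ w i)    ≤⟨ amgm s (λ i → y i j) ⟩
    (∑ λ i → w i * y i j) ^ r        ≤⟨ ^-monoˡ-≤ r (Σy≤rq j) ⟩
    (r * q j) ^ r                    ≡⟨ ^-distribʳ-* r r (q j) ⟩
    r ^ r * q j ^ r                  ∎)

-- Powers of 1 + 1/j and partial products of m!/m^m

-- This is (1 + x/L)^p (1 - px/L) ≤ 1 without subtraction: a factor (L + x)/L raises u by ux/L,
-- hence by at most x while u ≤ L, so p of them do not take u past L.
power-bernoulli : ∀ L x p u → u + p * x ≤ L → (L + x) ^ p * u ≤ L ^ p * L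
power-bernoulli L x zero    u h = +-monoˡ-≤ 0 (subst (_≤ L) (+-identityʳ u) h)
power-bernoulli L x (suc p) u h = begin
  (L + x) * (L + x) ^ p * u      ≡⟨ eq₁ (L + x) ((L + x) ^ p) u ⟩
  (L + x) ^ p * ((L + x) * u)    ≤⟨ *-monoʳ-≤ ((L + x) ^ p) step ⟩
  (L + x) ^ p * (L * (u + x))    ≡⟨ x∙yz≈y∙xz ((L + x) ^ p) L (u + x) ⟩
  L * ((L + x) ^ p * (u + x))    ≤⟨ *-monoʳ-≤ L (power-bernoulli L x p (u + x) (subst (_≤ L) (sym (+-assoc u x (p * x))) h)) ⟩
  L * (L ^ p * L)                ≡⟨ *-assoc L (L ^ p) L ⟨
  L * L ^ p * L                  ∎
  where
  open ≤-Reasoning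
  eq₁ : ∀ a b c → a * b * c ≡ b * (a * c)
  eq₁ = solve-∀
  eq₂ : ∀ L x u → (L + x) * u ≡ L * u + u * x
  eq₂ = solve-∀
  step : (L + x) * u ≤ L * (u + x)
  step = subst₂ _≤_ (sym (eq₂ L x u)) (sym (*-distribˡ-+ L u x))
           (+-monoʳ-≤ (L * u) (*-monoˡ-≤ x (m+n≤o⇒m≤o u h)))

*-distribˡ-listSum : ∀ c xs → c * sum xs ≡ sum (map (c *_) xs)
*-distribˡ-listSum c []       = *-zeroʳ c
*-distribˡ-listSum c (x ∷ xs) = trans (*-distribˡ-+ c x (sum xs)) (cong (c * x +_) (*-distribˡ-listSum c xs))

eNum-suc : ∀ p → eNum (suc p) ≡ suc p * eNum p + 1
eNum-suc p = begin
  sum (map (term (suc p)) (upTo (2 + p)))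
    ≡⟨ cong (sum ∘ map (term (suc p))) (upTo-∷ʳ (suc p)) ⟨
  sum (map (term (suc p)) (upTo (suc p) ∷ʳ suc p))
    ≡⟨ cong sum (map-++ (term (suc p)) (upTo (suc p)) [ suc p ]) ⟩
  sum (map (term (suc p)) (upTo (suc p)) ∷ʳ term (suc p) (suc p))
    ≡⟨ sum-++ (map (term (suc p)) (upTo (suc p))) [ term (suc p) (suc p) ] ⟩
  sum (map (term (suc p)) (upTo (suc p))) + (term (suc p) (suc p) + 0)
    ≡⟨ cong₂ _+_ (cong sum (trans (map-cong-local (All.tabulate term-suc)) (map-∘ (upTo (suc p)))))
                 (trans (+-identityʳ _) (n/n≡1 (suc p !) {{suc p !≢0}})) ⟩
  sum (map (suc p *_) (map (term p) (upTo (suc p)))) + 1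
    ≡⟨ cong (_+ 1) (*-distribˡ-listSum (suc p) (map (term p) (upTo (suc p)))) ⟨
  suc p * sum (map (term p) (upTo (suc p))) + 1 ∎
  where
  open ≡-Reasoning
  term : ℕ → ℕ → ℕ
  term p j = (p ! / j !) {{j !≢0}}
  term-suc : ∀ {j} → j ∈ upTo (suc p) → term (suc p) j ≡ suc p * term p j
  term-suc {j} j∈ = *-/-assoc (suc p) {{j !≢0}} (m≤n⇒m!∣n! (s≤s⁻¹ (∈-upTo⁻ j∈)))

falling : ℕ → ℕ → ℕ
falling n       zero    = 1
falling zero    (suc i) = 0
falling (suc n) (suc i) = suc n * falling n i

falling-step : ∀ n i → falling n (suc i) + i * falling n i ≡ n * falling n i
falling-step zero    zero    = refl
falling-step zero    (suc i) = *-zeroʳ i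
falling-step (suc n) zero    = +-identityʳ _
falling-step (suc n) (suc i) = begin
  suc n * falling n (suc i) + suc i * (suc n * falling n i)  ≡⟨ eq₁ n i (falling n (suc i)) (falling n i) ⟩
  suc n * (falling n i + (falling n (suc i) + i * falling n i))
    ≡⟨ cong (λ x → suc n * (falling n i + x)) (falling-step n i) ⟩
  suc n * (suc n * falling n i) ∎
  where
  open ≡-Reasoning
  eq₁ : ∀ n i x y → suc n * x + suc i * (suc n * y) ≡ suc n * (y + (x + i * y))
  eq₁ = solve-∀

-- Pascal's rule for C(n+1, i+1), multiplied by (i+1)!.
falling-suc : ∀ n i → falling (suc n) (suc i) ≡ falling n (suc i) + suc i * falling n i
falling-suc n i = trans (cong (falling n i +_) (sym (falling-step n i)))
                        (eq (falling n i) (falling n (suc i)) i)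
  where
  eq : ∀ y x i → y + (x + i * y) ≡ x + suc i * y
  eq = solve-∀

-- The smallest of the i factors, n + 1 - i, is at least l.
power≤falling : ∀ l n i → l + i ≤ suc n → l ^ i ≤ falling n i
power≤falling l n       zero    h = ≤-refl
power≤falling zero zero (suc i) h = z≤n
power≤falling (suc l) zero (suc i) h with s≤s h′ ← h with () ← subst (_≤ 0) (+-suc l i) h′
power≤falling l (suc n) (suc i) h = *-mono-≤ (m+n≤o⇒m≤o l h′) (power≤falling l n i h′)
  where
  h′ : l + i ≤ suc n
  h′ = s≤s⁻¹ (subst (_≤ suc (suc n)) (+-suc l i) h)

-- truncated J p N = p! J^p · Σ_{i ≤ p} C(N,i) / J^i, the truncated binomial expansion of (1 + 1/J)^N.
truncated : ℕ → ℕ → ℕ → ℕ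
truncated J zero    N = 1
truncated J (suc p) N = suc p * J * truncated J p N + falling N (suc p)

truncated-suc : ∀ J p N → truncated J (suc p) (suc N) ≡ truncated J (suc p) N + suc p * truncated J p N
truncated-suc J zero N = trans (cong (1 * J * 1 +_) (falling-suc N 0)) (sym (+-assoc (1 * J * 1) _ _))
truncated-suc J (suc p) N = begin
  suc (suc p) * J * truncated J (suc p) (suc N) + falling (suc N) (suc (suc p))
    ≡⟨ cong₂ (λ x y → suc (suc p) * J * x + y) (truncated-suc J p N) (falling-suc N (suc p)) ⟩
  suc (suc p) * J * (truncated J (suc p) N + suc p * truncated J p N)
    + (falling N (suc (suc p)) + suc (suc p) * falling N (suc p))
    ≡⟨ eq p J (truncated J p N) (falling N (suc p)) (falling N (suc (suc p))) ⟩
  truncated J (suc (suc p)) N + suc (suc p) * truncated J (suc p) N ∎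
  where
  open ≡-Reasoning
  eq : ∀ p J t f g → suc (suc p) * J * (suc p * J * t + f + suc p * t) + (g + suc (suc p) * f)
                   ≡ suc (suc p) * J * (suc p * J * t + f) + g + suc (suc p) * (suc p * J * t + f)
  eq = solve-∀

-- The untruncated sum would grow by exactly 1 + 1/J when N grows by 1; the truncated one misses the
-- contribution of its top term. Hence iteration from N = 0 bounds it by (1 + 1/J)^N.
truncated-ratio : ∀ J p N → J * truncated J p (suc N) ≤ suc J * truncated J p N
truncated-ratio J zero    N = *-monoˡ-≤ 1 (n≤1+n J)
truncated-ratio J (suc p) N = begin
  J * truncated J (suc p) (suc N)
    ≡⟨ cong (J *_) (truncated-suc J p N) ⟩
  J * (truncated J (suc p) N + suc p * truncated J p N)
    ≡⟨ eq J p (truncated J (suc p) N) (truncated J p N) ⟩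
  suc p * J * truncated J p N + J * truncated J (suc p) N
    ≤⟨ +-monoˡ-≤ _ (m≤m+n (suc p * J * truncated J p N) (falling N (suc p))) ⟩
  suc J * truncated J (suc p) N ∎
  where
  open ≤-Reasoning
  eq : ∀ J p x y → J * (x + suc p * y) ≡ suc p * J * y + J * x
  eq = solve-∀

truncated-zero : ∀ J p → truncated J p 0 ≡ p ! * J ^ p
truncated-zero J zero    = refl
truncated-zero J (suc p) = trans (+-identityʳ _)
  (trans (cong (suc p * J *_) (truncated-zero J p)) (eq (suc p) J (p !) (J ^ p)))
  where
  eq : ∀ a b c d → a * b * (c * d) ≡ a * c * (b * d)
  eq = solve-∀

truncated≤power : ∀ J p N → J ^ N * truncated J p N ≤ suc J ^ N * (p ! * J ^ p)
truncated≤power J p zero    = *-monoʳ-≤ 1 (≤-reflexive (truncated-zero J p))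
truncated≤power J p (suc N) = begin
  J * J ^ N * truncated J p (suc N)        ≡⟨ eq J (J ^ N) _ ⟩
  J ^ N * (J * truncated J p (suc N))      ≤⟨ *-monoʳ-≤ (J ^ N) (truncated-ratio J p N) ⟩
  J ^ N * (suc J * truncated J p N)        ≡⟨ x∙yz≈y∙xz (J ^ N) (suc J) _ ⟩
  suc J * (J ^ N * truncated J p N)        ≤⟨ *-monoʳ-≤ (suc J) (truncated≤power J p N) ⟩
  suc J * (suc J ^ N * (p ! * J ^ p))      ≡⟨ *-assoc (suc J) (suc J ^ N) _ ⟨
  suc J * suc J ^ N * (p ! * J ^ p)        ∎
  where
  open ≤-Reasoning
  eq : ∀ a b c → a * b * c ≡ b * (a * c)
  eq = solve-∀

-- Term by term: p!/i! · J^(p-i) · `falling J i` is at least p!/i! · l^p, as every one of the p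
-- factors is at least l.
eNum≤truncated : ∀ J l p → l + p ≤ suc J → eNum p * l ^ p ≤ truncated J p J
eNum≤truncated J l zero    h = ≤-refl
eNum≤truncated J l (suc p) h = begin
  eNum (suc p) * (l * l ^ p)                    ≡⟨ cong (_* (l * l ^ p)) (eNum-suc p) ⟩
  (suc p * eNum p + 1) * (l * l ^ p)            ≡⟨ eq (suc p) (eNum p) l (l ^ p) ⟩
  suc p * l * (eNum p * l ^ p) + l ^ suc p
    ≤⟨ +-mono-≤ (*-mono-≤ (*-monoʳ-≤ (suc p) (m+n≤o⇒m≤o l h′)) (eNum≤truncated J l p (m≤n⇒m≤1+n h′)))
                (power≤falling l J (suc p) h) ⟩
  suc p * J * truncated J p J + falling J (suc p) ∎
  where
  open ≤-Reasoning
  h′ : l + p ≤ J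
  h′ = s≤s⁻¹ (subst (_≤ suc J) (+-suc l p) h)
  eq : ∀ q e l x → (q * e + 1) * (l * x) ≡ q * l * (e * x) + l * x
  eq = solve-∀

-- (1 + 1/J)^J is at least (l/J)^p times the p-th partial sum of e. The loss (l/J)^p is paid for by
-- strictness, which over the integers reads a p! + 1 ≤ b · `eNum p`.
belowE⇒≤[1+1/J]^J : ∀ a b → BelowE a b → ∃ λ J → 1 ≤ J × a * J ^ J ≤ b * suc J ^ J
belowE⇒≤[1+1/J]^J a b (p , ap!<be) =
  J , 1≤J , *-cancelʳ-≤ _ _ (p ! * J ^ p) {{m*n≢0 (p !) (J ^ p) {{p !≢0}} {{m^n≢0 J p {{>-nonZero 1≤J}}}}}} (begin
    a * J ^ J * (p ! * J ^ p)            ≡⟨ eq₁ a (J ^ J) (p !) (J ^ p) ⟩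
    J ^ J * (J ^ p * z)                  ≤⟨ *-monoʳ-≤ (J ^ J) J^p*z≤ ⟩
    J ^ J * (l ^ p * suc z)              ≤⟨ *-monoʳ-≤ (J ^ J) (*-monoʳ-≤ (l ^ p) ap!<be) ⟩
    J ^ J * (l ^ p * (b * eNum p))       ≡⟨ eq₂ (J ^ J) (l ^ p) b (eNum p) ⟩
    b * (J ^ J * (eNum p * l ^ p))       ≤⟨ *-monoʳ-≤ b (*-monoʳ-≤ (J ^ J) (eNum≤truncated J l p (n≤1+n J))) ⟩
    b * (J ^ J * truncated J p J)        ≤⟨ *-monoʳ-≤ b (truncated≤power J p J) ⟩
    b * (suc J ^ J * (p ! * J ^ p))      ≡⟨ *-assoc b (suc J ^ J) _ ⟨
    b * suc J ^ J * (p ! * J ^ p)        ∎)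
  where
  open ≤-Reasoning
  z = a * p !
  -- Passing from l to J = l + p must not raise z ((l+p)/l)^p above z + 1. By `power-bernoulli` it
  -- suffices that z c + p² ≤ l = (z + 1) c.
  c = suc (p * p)
  l = suc z * c
  J = l + p
  1≤J : 1 ≤ J
  1≤J = s≤s z≤n
  eq₁ : ∀ a x y w → a * x * (y * w) ≡ x * (w * (a * y))
  eq₁ = solve-∀
  eq₂ : ∀ x y b e → x * (y * (b * e)) ≡ b * (x * (e * y))
  eq₂ = solve-∀
  u+pp≤l : z * c + p * p ≤ l
  u+pp≤l = subst (z * c + p * p ≤_) (+-comm (z * c) c) (+-monoʳ-≤ (z * c) (n≤1+n (p * p)))
  J^p*z≤ : J ^ p * z ≤ l ^ p * suc z
  J^p*z≤ = *-cancelʳ-≤ _ _ c (subst₂ _≤_ (sym (*-assoc (J ^ p) z c)) (sym (*-assoc (l ^ p) (suc z) c))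
             (power-bernoulli l p p (z * c) u+pp≤l))

-- (1 + 1/j)^j increases by AM-GM for the number 1 and j copies of 1 + 1/j, whose mean is 1 +
-- 1/(j+1); here they are scaled by j.
[1+1/j]^j-mono : ∀ a b j → 1 ≤ j → a * j ^ j ≤ b * suc j ^ j → a * suc j ^ suc j ≤ b * suc (suc j) ^ suc j
[1+1/j]^j-mono a b j 1≤j h = *-cancelʳ-≤ _ _ (suc j ^ j) {{m^n≢0 (suc j) j}} (begin
  a * suc j ^ suc j * suc j ^ j          ≡⟨ *-assoc a _ _ ⟩
  a * (suc j ^ suc j * suc j ^ j)        ≤⟨ *-monoʳ-≤ a step ⟩
  a * (j ^ j * suc (suc j) ^ suc j)      ≡⟨ *-assoc a _ _ ⟨
  a * j ^ j * suc (suc j) ^ suc j        ≤⟨ *-monoˡ-≤ _ h ⟩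
  b * suc j ^ j * suc (suc j) ^ suc j    ≡⟨ eq₀ b (suc j ^ j) _ ⟩
  b * suc (suc j) ^ suc j * suc j ^ j    ∎)
  where
  open ≤-Reasoning
  eq₀ : ∀ a b c → a * b * c ≡ a * c * b
  eq₀ = solve-∀
  eq₁ : ∀ x y j w → x * y * (j * w) ≡ x * (j * (w * y))
  eq₁ = solve-∀
  eq₂ : ∀ j → j + j * suc j ≡ j * suc (suc j)
  eq₂ = solve-∀
  eq₃ : ∀ x j y → x * (j * x * y) ≡ x * y * (j * x)
  eq₃ = solve-∀
  nz : NonZero (j ^ suc j)
  nz = m^n≢0 j (suc j) {{>-nonZero 1≤j}}
  step : suc j ^ suc j * suc j ^ j ≤ j ^ j * suc (suc j) ^ suc j
  step = *-cancelʳ-≤ _ _ (j ^ suc j) {{nz}} (begin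
    suc j ^ suc j * suc j ^ j * (j * j ^ j)        ≡⟨ eq₁ (suc j ^ suc j) (suc j ^ j) j (j ^ j) ⟩
    suc j ^ suc j * (j * (j ^ j * suc j ^ j))      ≡⟨ cong (λ x → suc j ^ suc j * (j * x)) (^-distribʳ-* j j (suc j)) ⟨
    suc j ^ suc j * (j * (j * suc j) ^ j)          ≤⟨ weighted-amgm₂ j j (j * suc j) ⟩
    j ^ j * (j + j * suc j) ^ suc j                ≡⟨ cong (λ x → j ^ j * x ^ suc j) (eq₂ j) ⟩
    j ^ j * (j * suc (suc j)) ^ suc j              ≡⟨ cong (j ^ j *_) (^-distribʳ-* (suc j) j (suc (suc j))) ⟩
    j ^ j * (j * j ^ j * suc (suc j) ^ suc j)      ≡⟨ eq₃ (j ^ j) j _ ⟩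
    j ^ j * suc (suc j) ^ suc j * (j * j ^ j)      ∎)

belowE⇒≤[1+1/j]^j : ∀ a b → BelowE a b → ∃ λ J → ∀ j → J ≤ j → a * j ^ j ≤ b * suc j ^ j
belowE⇒≤[1+1/j]^j a b a<be with belowE⇒≤[1+1/J]^J a b a<be
... | J , 1≤J , base = J , λ j J≤j → go (≤⇒≤′ J≤j)
  where
  go : ∀ {j} → J ≤′ j → a * j ^ j ≤ b * suc j ^ j
  go ≤′-refl             = base
  go (≤′-step {j} J≤′j) = [1+1/j]^j-mono a b j (≤-trans 1≤J (≤′⇒≤ J≤′j)) (go J≤′j)

-- Since a p! + 1 ≤ b · `eNum p`, any w > p! leaves room for the extra 1. The gain, a factor (aw +
-- 1)/(aw) per step, later absorbs the shift by 1/T.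
belowE-slack : ∀ a b → BelowE a b → ∃ λ w → 1 ≤ w × BelowE (suc (a * w)) (b * w)
belowE-slack a b (p , ap!<be) = w , s≤s z≤n , p , (begin
  suc (suc (a * w) * p !)      ≡⟨ eq₁ a w (p !) ⟩
  w + a * p ! * w              ≤⟨ *-monoˡ-≤ w ap!<be ⟩
  b * eNum p * w               ≡⟨ eq₂ b (eNum p) w ⟩
  b * w * eNum p               ∎)
  where
  open ≤-Reasoning
  w = suc (p !)
  eq₁ : ∀ a w x → suc (suc (a * w) * x) ≡ suc x + a * x * w
  eq₁ = solve-∀
  eq₂ : ∀ b e w → b * e * w ≡ b * w * e
  eq₂ = solve-∀

-- (q + m)!/q!, the factorial whose factors are shifted by q.
rise : ℕ → ℕ → ℕ
rise q zero    = 1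
rise q (suc m) = suc q * rise (suc q) m

∏≡rise : ∀ q m → ∏ {m} (λ j → suc (toℕ j) + q) ≡ rise q m
∏≡rise q zero    = refl
∏≡rise q (suc m) = cong (suc q *_) (trans (∏-cong {m} (λ j → sym (+-suc (suc (toℕ j)) q))) (∏≡rise (suc q) m))

rise-+ : ∀ q l m → rise q (l + m) ≡ rise q l * rise (l + q) m
rise-+ q zero    m = sym (+-identityʳ _)
rise-+ q (suc l) m = trans (cong (suc q *_) (trans (rise-+ (suc q) l m)
  (cong (λ x → rise (suc q) l * rise x m) (+-suc l q)))) (sym (*-assoc (suc q) (rise (suc q) l) (rise (suc (l + q)) m)))

rise≤power : ∀ q m → rise q m ≤ (m + q) ^ m
rise≤power q zero    = ≤-refl
rise≤power q (suc m) = *-mono-≤ (s≤s (m≤n+m q m))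
  (subst (λ x → rise (suc q) m ≤ x ^ m) (+-suc m q) (rise≤power (suc q) m))

-- Multiplied by j + 1, the hypothesis compares j^j with (j+1)^(j+1), and the product over q ≤ j < q
-- + m telescopes. This serves as Stirling's upper bound.
rise-telescope : ∀ a b J → (∀ j → J ≤ j → a * j ^ j ≤ b * suc j ^ j) →
                 ∀ q m → J ≤ q → a ^ m * rise q m * q ^ q ≤ b ^ m * (m + q) ^ (m + q)
rise-telescope a b J h q zero    J≤q = ≤-refl
rise-telescope a b J h q (suc m) J≤q = begin
  a * a ^ m * (suc q * rise (suc q) m) * q ^ q
    ≡⟨ eq₁ a (a ^ m) (suc q) (rise (suc q) m) (q ^ q) ⟩
  a * q ^ q * (suc q * (a ^ m * rise (suc q) m))
    ≤⟨ *-monoˡ-≤ _ (h q J≤q) ⟩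
  b * suc q ^ q * (suc q * (a ^ m * rise (suc q) m))
    ≡⟨ eq₂ b (suc q ^ q) (suc q) (a ^ m * rise (suc q) m) ⟩
  b * (a ^ m * rise (suc q) m * suc q ^ suc q)
    ≤⟨ *-monoʳ-≤ b (rise-telescope a b J h (suc q) m (m≤n⇒m≤1+n J≤q)) ⟩
  b * (b ^ m * (m + suc q) ^ (m + suc q))
    ≡⟨ cong (λ x → b * (b ^ m * x ^ x)) (+-suc m q) ⟩
  b * (b ^ m * suc (m + q) ^ suc (m + q))
    ≡⟨ *-assoc b (b ^ m) _ ⟨
  b * b ^ m * suc (m + q) ^ suc (m + q) ∎
  where
  open ≤-Reasoning
  eq₁ : ∀ a x q r y → a * x * (q * r) * y ≡ a * y * (q * (x * r))
  eq₁ = solve-∀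
  eq₂ : ∀ b y q r → b * y * (q * r) ≡ b * (r * (q * y))
  eq₂ = solve-∀

-- Only the factors up to m are telescoped. The q factors above m are at most 2m ≤ 2Tq each, and q^q
-- is left over from telescoping, so the loss is (2aT)^q. For q near m/T this is exponential in m at
-- a rate tending to 0 as T grows.
rise-bound : ∀ a b J .{{_ : NonZero b}} → (∀ j → J ≤ j → a * j ^ j ≤ b * suc j ^ j) →
             ∀ T q m .{{_ : NonZero q}} → J ≤ q → q ≤ m → m ≤ T * q →
             a ^ m * rise q m ≤ (2 * a * T) ^ q * (b ^ m * m ^ m)
rise-bound a b J h T q m J≤q q≤m m≤Tq = *-cancelʳ-≤ _ _ (q ^ q) {{m^n≢0 q q}} (begin
  a ^ m * rise q m * q ^ q
    ≡⟨ cong (_* q ^ q) (cong₂ _*_ (trans (cong (a ^_) (sym l+q≡m)) (^-distribˡ-+-* a l q))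
         (trans (cong (rise q) (sym l+q≡m)) (trans (rise-+ q l q) (cong (λ x → rise q l * rise x q) l+q≡m)))) ⟩
  a ^ l * a ^ q * (rise q l * rise m q) * q ^ q
    ≡⟨ eq₁ (a ^ l) (a ^ q) (rise q l) (rise m q) (q ^ q) ⟩
  a ^ l * rise q l * q ^ q * (a ^ q * rise m q)
    ≤⟨ *-mono-≤ (rise-telescope a b J h q l J≤q) (*-monoʳ-≤ (a ^ q) (≤-trans (rise≤power m q) (^-monoˡ-≤ q q+m≤))) ⟩
  b ^ l * (l + q) ^ (l + q) * (a ^ q * (2 * (T * q)) ^ q)
    ≤⟨ *-monoˡ-≤ _ (*-mono-≤ (^-monoʳ-≤ b (m∸n≤m m q)) (≤-reflexive (cong (λ x → x ^ x) l+q≡m))) ⟩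
  b ^ m * m ^ m * (a ^ q * (2 * (T * q)) ^ q)
    ≡⟨ cong (b ^ m * m ^ m *_) (trans (sym (^-distribʳ-* q a (2 * (T * q))))
         (trans (cong (_^ q) (eq₂ a T q)) (^-distribʳ-* q (2 * a * T) q))) ⟩
  b ^ m * m ^ m * ((2 * a * T) ^ q * q ^ q)
    ≡⟨ eq₃ (b ^ m * m ^ m) ((2 * a * T) ^ q) (q ^ q) ⟩
  (2 * a * T) ^ q * (b ^ m * m ^ m) * q ^ q ∎)
  where
  open ≤-Reasoning
  l = m ∸ q
  l+q≡m : l + q ≡ m
  l+q≡m = m∸n+n≡m q≤m
  q+m≤ : q + m ≤ 2 * (T * q)
  q+m≤ = subst (q + m ≤_) (cong (T * q +_) (sym (+-identityʳ (T * q)))) (+-mono-≤ (≤-trans q≤m m≤Tq) m≤Tq)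
  eq₁ : ∀ a b c d e → a * b * (c * d) * e ≡ a * c * e * (b * d)
  eq₁ = solve-∀
  eq₂ : ∀ a T q → a * (2 * (T * q)) ≡ 2 * a * T * q
  eq₂ = solve-∀
  eq₃ : ∀ a b c → a * (b * c) ≡ b * a * c
  eq₃ = solve-∀

-- Bernoulli gives (1 + 1/z)^y ≥ y/z; cubed, it exceeds 9K y² = K T² for T = 3y once y ≥ 9K z³. The
-- square T² comes from squaring the loss factor of `rise-bound` in `absorb`.
exponential-beats-quadratic : ∀ K z → ∃ λ T → 2 ≤ T × K * (T * T) * z ^ T ≤ suc z ^ T
exponential-beats-quadratic K zero = 2 , ≤-refl , subst (_≤ 1) (sym (*-zeroʳ (K * 4))) z≤n
exponential-beats-quadratic K z@(suc _) = y * 3 , 2≤T , *-cancelʳ-≤ _ _ (z ^ 3) {{m^n≢0 z 3}} (begin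
  K * (y * 3 * (y * 3)) * z ^ (y * 3) * z ^ 3      ≡⟨ eq K y (z ^ (y * 3)) (z ^ 3) ⟩
  z ^ (y * 3) * (y * (y * (9 * K * z ^ 3)))        ≤⟨ *-monoʳ-≤ (z ^ (y * 3)) (*-monoʳ-≤ y (*-monoʳ-≤ y (n≤1+n (9 * K * z ^ 3)))) ⟩
  z ^ (y * 3) * (y * (y * y))                      ≡⟨ cong₂ _*_ (^-*-assoc z y 3) (cong (λ x → y * (y * x)) (*-identityʳ y)) ⟨
  (z ^ y) ^ 3 * y ^ 3                              ≡⟨ ^-distribʳ-* 3 (z ^ y) y ⟨
  (z ^ y * y) ^ 3                                  ≤⟨ ^-monoˡ-≤ 3 (≤-trans (*-monoʳ-≤ (z ^ y) (m≤n+m y z)) (bern y)) ⟩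
  (suc z ^ y * z) ^ 3                              ≡⟨ ^-distribʳ-* 3 (suc z ^ y) z ⟩
  (suc z ^ y) ^ 3 * z ^ 3                          ≡⟨ cong (_* z ^ 3) (^-*-assoc (suc z) y 3) ⟩
  suc z ^ (y * 3) * z ^ 3                          ∎)
  where
  open ≤-Reasoning
  y = suc (9 * K * z ^ 3)
  2≤T : 2 ≤ y * 3
  2≤T = s≤s (s≤s z≤n)
  eq : ∀ K y a b → K * (y * 3 * (y * 3)) * a * b ≡ a * (y * (y * (9 * K * b)))
  eq = solve-∀
  eq′ : ∀ z x y → suc z * (x * (z + y)) ≡ z * x * (z + suc y) + x * y
  eq′ = solve-∀
  bern : ∀ y → z ^ y * (z + y) ≤ suc z ^ y * z
  bern zero    = ≤-reflexive (cong (1 *_) (+-identityʳ z))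
  bern (suc y) = begin
    z * z ^ y * (z + suc y)              ≤⟨ m≤m+n _ _ ⟩
    z * z ^ y * (z + suc y) + z ^ y * y  ≡⟨ eq′ z (z ^ y) y ⟨
    suc z * (z ^ y * (z + y))            ≤⟨ *-monoʳ-≤ (suc z) (bern y) ⟩
    suc z * (suc z ^ y * z)              ≡⟨ *-assoc (suc z) (suc z ^ y) z ⟨
    suc z * suc z ^ y * z                ∎

-- Each of the q factors K² is charged to T of the 2m factors z. The inequality is squared because
-- rounding m/T up only guarantees Tq ≤ 2m.
absorb : ∀ z K T q m → T * q ≤ 2 * m → K * K * z ^ T ≤ suc z ^ T → z ^ m * K ^ q ≤ suc z ^ m
absorb z K T q m Tq≤2m h = ^-cancelˡ-≤ 2 (begin
  (z ^ m * K ^ q) ^ 2                     ≡⟨ eq₁ (z ^ m) (K ^ q) ⟩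
  z ^ m * z ^ m * (K ^ q * K ^ q)         ≡⟨ cong₂ _*_ (twice z) (sym (^-distribʳ-* q K K)) ⟩
  z ^ (r + T * q) * (K * K) ^ q           ≡⟨ cong (_* (K * K) ^ q) (^-distribˡ-+-* z r (T * q)) ⟩
  z ^ r * z ^ (T * q) * (K * K) ^ q       ≡⟨ cong (λ x → z ^ r * x * (K * K) ^ q) (^-*-assoc z T q) ⟨
  z ^ r * (z ^ T) ^ q * (K * K) ^ q       ≡⟨ eq₂ (z ^ r) ((z ^ T) ^ q) ((K * K) ^ q) ⟩
  z ^ r * ((K * K) ^ q * (z ^ T) ^ q)     ≡⟨ cong (z ^ r *_) (^-distribʳ-* q (K * K) (z ^ T)) ⟨
  z ^ r * (K * K * z ^ T) ^ q             ≤⟨ *-mono-≤ (^-monoˡ-≤ r (n≤1+n z)) (^-monoˡ-≤ q h) ⟩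
  suc z ^ r * (suc z ^ T) ^ q             ≡⟨ cong (suc z ^ r *_) (^-*-assoc (suc z) T q) ⟩
  suc z ^ r * suc z ^ (T * q)             ≡⟨ ^-distribˡ-+-* (suc z) r (T * q) ⟨
  suc z ^ (r + T * q)                     ≡⟨ twice (suc z) ⟨
  suc z ^ m * suc z ^ m                   ≡⟨ cong (suc z ^ m *_) (*-identityʳ (suc z ^ m)) ⟨
  (suc z ^ m) ^ 2                         ∎)
  where
  open ≤-Reasoning
  r = 2 * m ∸ T * q
  twice : ∀ z → z ^ m * z ^ m ≡ z ^ (r + T * q)
  twice z = trans (sym (^-distribˡ-+-* z m m))
    (cong (z ^_) (trans (cong (m +_) (sym (+-identityʳ m))) (sym (m∸n+n≡m Tq≤2m))))
  eq₁ : ∀ a b → a * b * (a * b * 1) ≡ a * a * (b * b)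
  eq₁ = solve-∀
  eq₂ : ∀ a b c → a * b * c ≡ a * (c * b)
  eq₂ = solve-∀

-- The shift by 1/T absorbs the bad edges, as (j/m)^e + (1/T)^e ≤ (j/m + 1/T)^e. It is affordable
-- because (m!/m^m)^(1/m) tends to 1/e, and 1/e < b/a is strict.
shifted-factorial-bound : ∀ a b → BelowE a b → ∃ λ T → 1 ≤ T × ∃ λ m₀ → ∀ m → m₀ ≤ m →
  a ^ m * ∏ {m} (λ j → T * suc (toℕ j) + m) ≤ b ^ m * (m * T) ^ m
shifted-factorial-bound a b a<be with belowE-slack a b a<be
... | w , 1≤w , a′<b′e@(p , lt) with belowE⇒≤[1+1/j]^j (suc (a * w)) (b * w) a′<b′e
                 | exponential-beats-quadratic (4 * (suc (a * w) * suc (a * w))) (a * w)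
... | J , h | T , 2≤T , KTT≤ = T , 1≤T , T * suc J , bound
  where
  open ≤-Reasoning
  z = a * w
  b′ = b * w
  1≤T : 1 ≤ T
  1≤T = ≤-trans (n≤1+n 1) 2≤T
  instance
    b′≢0 : NonZero b′
    b′≢0 = ≢-nonZero λ b′≡0 → n≮0 (subst (λ x → suc z * p ! < x * eNum p) b′≡0 lt)
    T≢0 : NonZero T
    T≢0 = >-nonZero 1≤T
    w≢0 : NonZero w
    w≢0 = >-nonZero 1≤w
  eq₁ : ∀ A T x → 2 * A * T * (2 * A * T) * x ≡ 4 * (A * A) * (T * T) * x
  eq₁ = solve-∀
  eq₃ : ∀ T a b → T * a + T * b ≡ T * (a + b)
  eq₃ = solve-∀
  eq₄ : ∀ a w r → a * r * w ≡ a * w * r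
  eq₄ = solve-∀
  eq₅ : ∀ t b m → t * (b * m) ≡ b * (m * t)
  eq₅ = solve-∀
  bound : ∀ m → T * suc J ≤ m → a ^ m * ∏ {m} (λ j → T * suc (toℕ j) + m) ≤ b ^ m * (m * T) ^ m
  bound m TJ≤m = begin
    a ^ m * ∏ {m} (λ j → T * suc (toℕ j) + m)
      ≤⟨ *-monoʳ-≤ (a ^ m) (∏-mono {m} λ j → ≤-trans (+-monoʳ-≤ (T * suc (toℕ j)) m≤Tq) (≤-reflexive (eq₃ T (suc (toℕ j)) q))) ⟩
    a ^ m * ∏ {m} (λ j → T * (suc (toℕ j) + q))
      ≡⟨ cong (a ^ m *_) (trans (∏-scale {m} T (λ j → suc (toℕ j) + q)) (cong (T ^ m *_) (∏≡rise q m))) ⟩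
    a ^ m * (T ^ m * rise q m)
      ≡⟨ x∙yz≈y∙xz (a ^ m) (T ^ m) (rise q m) ⟩
    T ^ m * (a ^ m * rise q m)
      ≤⟨ *-monoʳ-≤ (T ^ m) unshifted ⟩
    T ^ m * (b ^ m * m ^ m)
      ≡⟨ eq₅ (T ^ m) (b ^ m) (m ^ m) ⟩
    b ^ m * (m ^ m * T ^ m)
      ≡⟨ cong (b ^ m *_) (^-distribʳ-* m m T) ⟨
    b ^ m * (m * T) ^ m ∎
    where
    q = suc (m / T)
    m≤Tq : m ≤ T * q
    m≤Tq = begin
      m                        ≡⟨ m≡m%n+[m/n]*n m T ⟩
      m % T + m / T * T        ≤⟨ +-monoˡ-≤ _ (<⇒≤ (m%n<n m T)) ⟩
      T + m / T * T            ≡⟨ *-comm q T ⟩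
      T * q                    ∎
    T≤m : T ≤ m
    T≤m = ≤-trans (m≤m*n T (suc J)) TJ≤m
    Tq≤2m : T * q ≤ 2 * m
    Tq≤2m = begin
      T * q              ≡⟨ *-comm T q ⟩
      T + m / T * T      ≤⟨ +-mono-≤ T≤m (m/n*n≤m m T) ⟩
      m + m              ≡⟨ cong (m +_) (+-identityʳ m) ⟨
      2 * m              ∎
    J≤q : J ≤ q
    J≤q = ≤-trans (n≤1+n J) (*-cancelˡ-≤ T (≤-trans TJ≤m m≤Tq))
    q≤m : q ≤ m
    q≤m = *-cancelˡ-≤ 2 (≤-trans (*-monoˡ-≤ q 2≤T) Tq≤2m)
    K = 2 * suc z * T
    unshifted : a ^ m * rise q m ≤ b ^ m * m ^ m
    -- The estimate is made for (z + 1)/(bw), still below e, in place of a/b = z/(bw). The factor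
    -- ((z + 1)/z)^m gained this way pays for the loss K^q.
    unshifted = *-cancelʳ-≤ _ _ (w ^ m) {{m^n≢0 w m}} (*-cancelˡ-≤ (suc z ^ m) {{m^n≢0 (suc z) m}} (begin
      suc z ^ m * (a ^ m * rise q m * w ^ m)
        ≡⟨ cong (suc z ^ m *_) (eq₄ (a ^ m) (w ^ m) (rise q m)) ⟩
      suc z ^ m * (a ^ m * w ^ m * rise q m)
        ≡⟨ cong (λ x → suc z ^ m * (x * rise q m)) (^-distribʳ-* m a w) ⟨
      suc z ^ m * (z ^ m * rise q m)
        ≡⟨ x∙yz≈y∙xz (suc z ^ m) (z ^ m) (rise q m) ⟩
      z ^ m * (suc z ^ m * rise q m)
        ≤⟨ *-monoʳ-≤ (z ^ m) (rise-bound (suc z) b′ J h T q m J≤q q≤m m≤Tq) ⟩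
      z ^ m * (K ^ q * (b′ ^ m * m ^ m))
        ≡⟨ *-assoc (z ^ m) (K ^ q) _ ⟨
      z ^ m * K ^ q * (b′ ^ m * m ^ m)
        ≤⟨ *-monoˡ-≤ _ (absorb z K T q m Tq≤2m (subst (_≤ suc z ^ T) (sym (eq₁ (suc z) T (z ^ T))) KTT≤)) ⟩
      suc z ^ m * (b′ ^ m * m ^ m)
        ≡⟨ cong (λ x → suc z ^ m * (x * m ^ m)) (^-distribʳ-* m b w) ⟩
      suc z ^ m * (b ^ m * w ^ m * m ^ m)
        ≡⟨ cong (suc z ^ m *_) (eq₄ (b ^ m) (w ^ m) (m ^ m)) ⟨
      suc z ^ m * (b ^ m * m ^ m * w ^ m) ∎))

-- Sums over sub-collections of edges

𝟙 : ∀ {A : Set} → Dec A → ℕ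
𝟙 a? = ι (does a?)

𝟙-true : ∀ {A : Set} (a? : Dec A) → A → 𝟙 a? ≡ 1
𝟙-true a? a = cong ι (dec-true a? a)

𝟙-guard : ∀ {A : Set} (a? : Dec A) {x y} → (A → x ≤ y) → 𝟙 a? * x ≤ 𝟙 a? * y
𝟙-guard (yes a) h = *-monoʳ-≤ 1 (h a)
𝟙-guard (no _)  h = z≤n

𝟙-cong : ∀ {A B : Set} (a? : Dec A) (b? : Dec B) → (A → B) → (B → A) → 𝟙 a? ≡ 𝟙 b?
𝟙-cong a? b? f g = cong ι (does-⇔ (mk⇔ f g) a? b?)

𝟙-mono : ∀ {A B : Set} (a? : Dec A) (b? : Dec B) → (A → B) → 𝟙 a? ≤ 𝟙 b?
𝟙-mono (yes a) b? h = ≤-reflexive (sym (𝟙-true b? (h a)))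
𝟙-mono (no _)  b? h = z≤n

∑ˢ : ∀ {L} → (Vec Bool L → ℕ) → ℕ
∑ˢ {zero}  f = f []
∑ˢ {suc L} f = ∑ˢ (f ∘ (true ∷_)) + ∑ˢ (f ∘ (false ∷_))

∑ˢ-mono : ∀ {L} {f g : Vec Bool L → ℕ} → (∀ s → f s ≤ g s) → ∑ˢ f ≤ ∑ˢ g
∑ˢ-mono {zero}  h = h []
∑ˢ-mono {suc L} h = +-mono-≤ (∑ˢ-mono (h ∘ (true ∷_))) (∑ˢ-mono (h ∘ (false ∷_)))

∑ˢ-cong : ∀ {L} {f g : Vec Bool L → ℕ} → (∀ s → f s ≡ g s) → ∑ˢ f ≡ ∑ˢ g
∑ˢ-cong {zero}  h = h []
∑ˢ-cong {suc L} h = cong₂ _+_ (∑ˢ-cong (h ∘ (true ∷_))) (∑ˢ-cong (h ∘ (false ∷_)))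

*-distribˡ-∑ˢ : ∀ {L} c (f : Vec Bool L → ℕ) → c * ∑ˢ f ≡ ∑ˢ (λ s → c * f s)
*-distribˡ-∑ˢ {zero}  c f = refl
*-distribˡ-∑ˢ {suc L} c f = trans (*-distribˡ-+ c (∑ˢ (f ∘ (true ∷_))) (∑ˢ (f ∘ (false ∷_))))
  (cong₂ _+_ (*-distribˡ-∑ˢ c (f ∘ (true ∷_))) (*-distribˡ-∑ˢ c (f ∘ (false ∷_))))

∑ˢ-∑-comm : ∀ {L k} (f : Vec Bool L → Fin k → ℕ) → ∑ˢ (λ s → ∑ (f s)) ≡ ∑ (λ i → ∑ˢ λ s → f s i)
∑ˢ-∑-comm {zero}  f = refl
∑ˢ-∑-comm {suc L} f = trans (cong₂ _+_ (∑ˢ-∑-comm (f ∘ (true ∷_))) (∑ˢ-∑-comm (f ∘ (false ∷_))))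
  (sym (∑-distrib-+ (λ i → ∑ˢ λ s → f (true ∷ s) i) (λ i → ∑ˢ λ s → f (false ∷ s) i)))

∑ˢ-zero : ∀ {L} (f : Vec Bool L → ℕ) → (∀ s → f s ≡ 0) → ∑ˢ f ≡ 0
∑ˢ-zero {zero}  f h = h []
∑ˢ-zero {suc L} f h = cong₂ _+_ (∑ˢ-zero _ (h ∘ (true ∷_))) (∑ˢ-zero _ (h ∘ (false ∷_)))

∑ˢ-nonzero : ∀ {L} (f : Vec Bool L → ℕ) → ∑ˢ f ≢ 0 → ∃ λ s → f s ≢ 0
∑ˢ-nonzero {zero}  f h = [] , h
∑ˢ-nonzero {suc L} f h with ∑ˢ (f ∘ (true ∷_)) ≟ 0
... | no ≢0 with s , fs≢0 ← ∑ˢ-nonzero (f ∘ (true ∷_)) ≢0 = true ∷ s , fs≢0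
... | yes ≡0 with s , fs≢0 ← ∑ˢ-nonzero (f ∘ (false ∷_)) (λ e → h (cong₂ _+_ ≡0 e)) = false ∷ s , fs≢0

-- Deleting i is injective on the collections that contain i.
∑ˢ-remove : ∀ {L} (h : Vec Bool L → ℕ) i → ∑ˢ (λ s → ι (lookup s i) * h (s [ i ]≔ false)) ≤ ∑ˢ h
∑ˢ-remove {suc L} h zero = begin
  ∑ˢ (λ s → h (false ∷ s) + 0) + ∑ˢ {L} (λ s → 0)
    ≡⟨ cong₂ _+_ (∑ˢ-cong (λ s → +-identityʳ (h (false ∷ s)))) (∑ˢ-zero {L} (λ s → 0) (λ s → refl)) ⟩
  ∑ˢ (h ∘ (false ∷_)) + 0
    ≡⟨ +-identityʳ _ ⟩
  ∑ˢ (h ∘ (false ∷_))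
    ≤⟨ m≤n+m _ _ ⟩
  ∑ˢ h ∎
  where open ≤-Reasoning
∑ˢ-remove {suc L} h (suc i) = +-mono-≤ (∑ˢ-remove (h ∘ (true ∷_)) i) (∑ˢ-remove (h ∘ (false ∷_)) i)

∑ˢ-empty : ∀ {L} (h : Vec Bool L → ℕ) → ∑ˢ (λ s → 𝟙 (size s ≟ 0) * h s) ≤ h (replicate L false)
∑ˢ-empty {zero}  h = ≤-reflexive (+-identityʳ (h []))
∑ˢ-empty {suc L} h = begin
  ∑ˢ (λ s → 𝟙 (size (true ∷ s) ≟ 0) * h (true ∷ s)) + ∑ˢ (λ s → 𝟙 (size s ≟ 0) * h (false ∷ s))
    ≡⟨ cong (_+ ∑ˢ (λ s → 𝟙 (size s ≟ 0) * h (false ∷ s))) (∑ˢ-zero {L} (λ s → 0) (λ s → refl)) ⟩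
  ∑ˢ (λ s → 𝟙 (size s ≟ 0) * h (false ∷ s))
    ≤⟨ ∑ˢ-empty (h ∘ (false ∷_)) ⟩
  h (replicate (suc L) false) ∎
  where open ≤-Reasoning

-- Makes all reciprocals 1/P integral at once, as `Q s` = Δ / `P s` wherever `P s` is nonzero.
commonMultiple : ∀ {L} (P : Vec Bool L → ℕ) →
  ∃ λ Δ → NonZero Δ × ∃ λ (Q : Vec Bool L → ℕ) → ∀ s → NonZero (P s) → Q s * P s ≡ Δ
commonMultiple {zero} P with P [] in eq
... | zero      = 1 , _ , (λ _ → 1) , λ { [] P≢0 → contradiction eq (≢-nonZero⁻¹ _ {{P≢0}}) }
... | p@(suc _) = p , _ , (λ _ → 1) , λ { [] _ → trans (+-identityʳ _) eq }
commonMultiple {suc L} P with commonMultiple (P ∘ (true ∷_)) | commonMultiple (P ∘ (false ∷_))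
... | Δ₁ , nz₁ , Q₁ , h₁ | Δ₂ , nz₂ , Q₂ , h₂ = Δ₁ * Δ₂ , m*n≢0 Δ₁ Δ₂ {{nz₁}} {{nz₂}} , Q , h
  where
  Q : Vec Bool (suc L) → ℕ
  Q (true ∷ s)  = Δ₂ * Q₁ s
  Q (false ∷ s) = Δ₁ * Q₂ s
  h : ∀ s → NonZero (P s) → Q s * P s ≡ Δ₁ * Δ₂
  h (true ∷ s)  nz = trans (*-assoc Δ₂ (Q₁ s) _) (trans (cong (Δ₂ *_) (h₁ s nz)) (*-comm Δ₂ Δ₁))
  h (false ∷ s) nz = trans (*-assoc Δ₁ (Q₂ s) _) (cong (Δ₁ *_) (h₂ s nz))

∑∈-remove : ∀ {L} (s : Vec Bool L) i (a : Fin L → ℕ) → lookup s i ≡ true →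
  ∑ (λ k → ι (lookup s k) * a k) ≡ a i + ∑ (λ k → ι (lookup (s [ i ]≔ false) k) * a k)
∑∈-remove (true ∷ s) zero    a refl = cong (_+ ∑ (λ k → ι (lookup s k) * a (suc k))) (+-identityʳ (a zero))
∑∈-remove (b ∷ s)    (suc i) a i∈s  = trans (cong (ι b * a zero +_) (∑∈-remove s i (a ∘ suc) i∈s))
  (eq (ι b * a zero) (a (suc i)) (∑ (λ k → ι (lookup (s [ i ]≔ false) k) * a (suc k))))
  where
  eq : ∀ x y z → x + (y + z) ≡ y + (x + z)
  eq = solve-∀

size-remove : ∀ {L} (s : Vec Bool L) i → lookup s i ≡ true → size s ≡ suc (size (s [ i ]≔ false))
size-remove s i i∈s = trans (∑1 s) (trans (∑∈-remove s i (λ _ → 1) i∈s) (cong suc (sym (∑1 (s [ i ]≔ false)))))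
  where
  ∑1 : ∀ {L} (s : Vec Bool L) → size s ≡ ∑ (λ k → ι (lookup s k) * 1)
  ∑1 s = ∑-cong λ k → sym (*-identityʳ (ι (lookup s k)))

size>0⇒member : ∀ {L} (s : Vec Bool L) → 1 ≤ size s → ∃ λ i → lookup s i ≡ true
size>0⇒member (true ∷ s)  h = zero , refl
size>0⇒member (false ∷ s) h with i , i∈s ← size>0⇒member s h = suc i , i∈s

-- Weights of partial matchings and their recursion

module Matchings {L n : ℕ} (inc : Fin L → Fin n → Bool) (d′ : ℕ)
                 (uniform : ∀ i → ∑ (λ v → ι (inc i v)) ≡ suc d′) where

  d : ℕ
  d = suc d′

  cov : Vec Bool L → Fin n → ℕ
  cov s v = ∑ λ i → ι (lookup s i) * ι (inc i v)

  meet : Fin L → Fin L → ℕ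
  meet f i = ∑ λ v → ι (inc f v) * ι (inc i v)

  met : Vec Bool L → Fin L → ℕ
  met s f = ∑ λ i → ι (lookup s i) * (1 ⊓ meet f i)

  Inside : (Fin n → ℕ) → Fin L → Set
  Inside χ f = ∀ v → ι (inc f v) ≤ χ v

  abstract
    inside? : ∀ χ f → Dec (Inside χ f)
    inside? χ f = Fin.all? λ v → ι (inc f v) ≤? χ v

  -- The single equation for `cov` expresses disjointness and exact covering together. A general U
  -- is kept because deleting an edge leaves a matching of a smaller vertex set.
  Matching : Vec Bool L → (Fin n → Bool) → ℕ → Set
  Matching s U r = size s ≡ r × (∀ v → cov s v ≡ ι (U v))

  abstract
    matching? : ∀ s U r → Dec (Matching s U r)
    matching? s U r = (size s ≟ r) ×-dec Fin.all? λ v → cov s v ≟ ι (U v)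

  -- p r s j / r^d, for j ≤ r = |s|, dominates 1/j times the expected number of edges contained in a
  -- uniformly random j-element subset of the matching s: an edge that meets t elements of s
  -- survives with probability at most (j/r)^t.
  p : ℕ → Vec Bool L → ℕ → ℕ
  p r s j = ∑ λ f → 𝟙 (inside? (cov s) f) * (j ^ (met s f ∸ 1) * r ^ (d ∸ met s f))

  -- Each factor already contains the division by j, so 1/P carries the r! of the removal orders.
  P : ℕ → Vec Bool L → ℕ
  P r s = ∏ {r} λ j → p r s (suc (toℕ j))

  cov-remove : ∀ s i v → lookup s i ≡ true → cov s v ≡ ι (inc i v) + cov (s [ i ]≔ false) v
  cov-remove s i v i∈s = ∑∈-remove s i (λ k → ι (inc k v)) i∈s

  member-inside : ∀ s i → lookup s i ≡ true → Inside (cov s) i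
  member-inside s i i∈s v = subst (ι (inc i v) ≤_) (sym (cov-remove s i v i∈s)) (m≤m+n _ _)

  matching-remove : ∀ s U r i → Matching s U (suc r) → lookup s i ≡ true →
                    Matching (s [ i ]≔ false) (λ v → U v ∧ not (inc i v)) r
  matching-remove s U r i (size≡ , cov≡) i∈s =
    suc-injective (trans (sym (size-remove s i i∈s)) size≡) ,
    λ v → go (U v) (inc i v) (trans (sym (cov-remove s i v i∈s)) (cov≡ v))
    where
    go : ∀ a b {x} → ι b + x ≡ ι a → x ≡ ι (a ∧ not b)
    go true  true  e = suc-injective e
    go true  false e = e
    go false false e = e

  ∑meet≡∑cov : ∀ s f → ∑ (λ i → ι (lookup s i) * meet f i) ≡ ∑ (λ v → ι (inc f v) * cov s v)
  ∑meet≡∑cov s f = begin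
    ∑ (λ i → w i * meet f i)
      ≡⟨ ∑-cong (λ i → *-distribˡ-sum (w i) (λ v → ι (inc f v) * ι (inc i v))) ⟩
    ∑ (λ i → ∑ λ v → w i * (ι (inc f v) * ι (inc i v)))
      ≡⟨ ∑-comm (λ i v → w i * (ι (inc f v) * ι (inc i v))) ⟩
    ∑ (λ v → ∑ λ i → w i * (ι (inc f v) * ι (inc i v)))
      ≡⟨ ∑-cong (λ v → ∑-cong λ i → x∙yz≈y∙xz (w i) (ι (inc f v)) (ι (inc i v))) ⟩
    ∑ (λ v → ∑ λ i → ι (inc f v) * (w i * ι (inc i v)))
      ≡⟨ ∑-cong (λ v → *-distribˡ-sum (ι (inc f v)) (λ i → w i * ι (inc i v))) ⟨
    ∑ (λ v → ι (inc f v) * cov s v) ∎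
    where
    open ≡-Reasoning
    w : Fin L → ℕ
    w i = ι (lookup s i)

  meet≤d : ∀ f i → meet f i ≤ d
  meet≤d f i = subst (meet f i ≤_) (uniform f)
    (∑-mono λ v → ≤-trans (*-monoʳ-≤ (ι (inc f v)) (ι≤1 (inc i v))) (≤-reflexive (*-identityʳ _)))

  inside⇒d≤∑meet : ∀ s f → Inside (cov s) f → d ≤ ∑ (λ i → ι (lookup s i) * meet f i)
  inside⇒d≤∑meet s f f⊆s = subst₂ _≤_ (uniform f) (sym (∑meet≡∑cov s f))
    (∑-mono λ v → go (inc f v) (f⊆s v))
    where
    go : ∀ b {c} → ι b ≤ c → ι b ≤ ι b * c
    go true  h = ≤-trans h (≤-reflexive (sym (+-identityʳ _)))
    go false h = z≤n

  -- The d incidences of f with members of s are shared among members that take at most d each.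
  -- Positivity makes `met s f ∸ 1` in `p` a true subtraction.
  met≥1 : ∀ s f → Inside (cov s) f → 1 ≤ met s f
  met≥1 s f f⊆s = *-cancelˡ-≤ d (begin
    d * 1                                                 ≡⟨ *-identityʳ d ⟩
    d                                                     ≤⟨ inside⇒d≤∑meet s f f⊆s ⟩
    ∑ (λ i → ι (lookup s i) * meet f i)                   ≤⟨ ∑-mono (λ i → *-monoʳ-≤ (ι (lookup s i)) (meet≤ (meet f i) (meet≤d f i))) ⟩
    ∑ (λ i → ι (lookup s i) * (d * (1 ⊓ meet f i)))       ≡⟨ ∑-cong (λ i → x∙yz≈y∙xz (ι (lookup s i)) d (1 ⊓ meet f i)) ⟩
    ∑ (λ i → d * (ι (lookup s i) * (1 ⊓ meet f i)))       ≡⟨ *-distribˡ-sum d (λ i → ι (lookup s i) * (1 ⊓ meet f i)) ⟨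
    d * met s f                                           ∎)
    where
    open ≤-Reasoning
    meet≤ : ∀ x → x ≤ d → x ≤ d * (1 ⊓ x)
    meet≤ zero    x≤d = z≤n
    meet≤ (suc x) x≤d = ≤-trans x≤d (≤-reflexive (sym (*-identityʳ d)))

  met≤d : ∀ s U r f → Matching s U r → met s f ≤ d
  met≤d s U r f (_ , cov≡) = begin
    met s f                                   ≤⟨ ∑-mono (λ i → *-monoʳ-≤ (ι (lookup s i)) (m⊓n≤n 1 (meet f i))) ⟩
    ∑ (λ i → ι (lookup s i) * meet f i)       ≡⟨ ∑meet≡∑cov s f ⟩
    ∑ (λ v → ι (inc f v) * cov s v)           ≤⟨ ∑-mono (λ v → *-monoʳ-≤ (ι (inc f v)) (≤-trans (≤-reflexive (cov≡ v)) (ι≤1 (U v)))) ⟩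
    ∑ (λ v → ι (inc f v) * 1)                 ≡⟨ ∑-cong (λ v → *-identityʳ (ι (inc f v))) ⟩
    ∑ (λ v → ι (inc f v))                     ≡⟨ uniform f ⟩
    d                                         ∎
    where open ≤-Reasoning

  inside-remove⇒inside : ∀ s i f → lookup s i ≡ true → Inside (cov (s [ i ]≔ false)) f → Inside (cov s) f
  inside-remove⇒inside s i f i∈s f⊆ v =
    ≤-trans (f⊆ v) (subst (cov (s [ i ]≔ false) v ≤_) (sym (cov-remove s i v i∈s)) (m≤n+m _ _))

  -- A common vertex would be covered once by i and once more by the rest.
  inside-remove⇒meet≡0 : ∀ s U r i f → Matching s U r → lookup s i ≡ true →
                         Inside (cov (s [ i ]≔ false)) f → meet f i ≡ 0
  inside-remove⇒meet≡0 s U r i f (_ , cov≡) i∈s f⊆ = trans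
    (∑-cong λ v → go (inc f v) (inc i v) (f⊆ v)
      (≤-trans (≤-reflexive (trans (sym (cov-remove s i v i∈s)) (cov≡ v))) (ι≤1 (U v))))
    (trans (∑-const n 0) (*-zeroʳ n))
    where
    go : ∀ a b {x} → ι a ≤ x → ι b + x ≤ 1 → ι a * ι b ≡ 0
    go true  false _       _        = refl
    go false b     _       _        = refl
    go true  true  (s≤s _) (s≤s ())

  inside-remove⇒met≡ : ∀ s U r i f → Matching s U r → lookup s i ≡ true →
                       Inside (cov (s [ i ]≔ false)) f → met s f ≡ met (s [ i ]≔ false) f
  inside-remove⇒met≡ s U r i f M i∈s f⊆ = trans (∑∈-remove s i (λ k → 1 ⊓ meet f k) i∈s)
    (cong (λ x → 1 ⊓ x + met (s [ i ]≔ false) f) (inside-remove⇒meet≡0 s U r i f M i∈s f⊆))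

  survivors : Vec Bool L → Fin L → ℕ
  survivors s f = ∑ λ i → ι (lookup s i) * 𝟙 (inside? (cov (s [ i ]≔ false)) f)

  -- No member is counted twice: deleting one that meets f uncovers a vertex of f. So f survives a
  -- uniform removal with probability at most 1 - t/|s|.
  survivors+met≤size : ∀ s U r f → Matching s U r → survivors s f + met s f ≤ size s
  survivors+met≤size s U r f M = subst (_≤ size s)
    (∑-distrib-+ (λ i → ι (lookup s i) * 𝟙 (inside? (cov (s [ i ]≔ false)) f)) (λ i → ι (lookup s i) * (1 ⊓ meet f i)))
    (∑-mono pointwise)
    where
    pointwise : ∀ i → ι (lookup s i) * 𝟙 (inside? (cov (s [ i ]≔ false)) f) + ι (lookup s i) * (1 ⊓ meet f i)
                    ≤ ι (lookup s i)
    pointwise i with lookup s i in i∈s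
    ... | false = z≤n
    ... | true with inside? (cov (s [ i ]≔ false)) f
    ...   | yes f⊆ = ≤-reflexive (cong (λ x → suc (1 ⊓ x + 0)) (inside-remove⇒meet≡0 s U r i f M i∈s f⊆))
    ...   | no _   = ≤-trans (≤-reflexive (+-identityʳ _)) (m⊓n≤m 1 (meet f i))

  -- An edge that survives keeps its t, so its term (j/(r+1))^t becomes (j/r)^t; this is outweighed
  -- by the survival probability, at most 1 - t/(r+1) ≤ (r/(r+1))^t.
  p-supermartingale : ∀ s U r j → Matching s U (suc r) →
    ∑ (λ i → ι (lookup s i) * (suc r ^ d * p r (s [ i ]≔ false) j)) ≤ suc r * (r ^ d * p (suc r) s j)
  p-supermartingale s U r j M@(size≡ , _) = begin
    ∑ (λ i → w i * (suc r ^ d * p r (s′ i) j))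
      ≡⟨ ∑-cong (λ i → trans (eq₁ (w i) (suc r ^ d) (p r (s′ i) j))
           (*-distribˡ-sum (suc r ^ d * w i) (λ f → in′ i f * (j ^ (met (s′ i) f ∸ 1) * r ^ (d ∸ met (s′ i) f))))) ⟩
    ∑ (λ i → ∑ λ f → suc r ^ d * w i * (in′ i f * (j ^ (met (s′ i) f ∸ 1) * r ^ (d ∸ met (s′ i) f))))
      ≤⟨ ∑-mono (λ i → ∑-mono λ f → pointwise i f) ⟩
    ∑ (λ i → ∑ λ f → c f * (w i * in′ i f))
      ≡⟨ ∑-comm (λ i f → c f * (w i * in′ i f)) ⟩
    ∑ (λ f → ∑ λ i → c f * (w i * in′ i f))
      ≡⟨ ∑-cong (λ f → *-distribˡ-sum (c f) (λ i → w i * in′ i f)) ⟨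
    ∑ (λ f → c f * survivors s f)
      ≤⟨ ∑-mono perEdge ⟩
    ∑ (λ f → suc r * r ^ d * (in₀ f * (j ^ (met s f ∸ 1) * suc r ^ (d ∸ met s f))))
      ≡⟨ *-distribˡ-sum (suc r * r ^ d) (λ f → in₀ f * (j ^ (met s f ∸ 1) * suc r ^ (d ∸ met s f))) ⟨
    suc r * r ^ d * p (suc r) s j
      ≡⟨ *-assoc (suc r) (r ^ d) _ ⟩
    suc r * (r ^ d * p (suc r) s j) ∎
    where
    open ≤-Reasoning
    w : Fin L → ℕ
    w i = ι (lookup s i)
    s′ : Fin L → Vec Bool L
    s′ i = s [ i ]≔ false
    in′ : Fin L → Fin L → ℕ
    in′ i f = 𝟙 (inside? (cov (s′ i)) f)
    in₀ : Fin L → ℕ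
    in₀ f = 𝟙 (inside? (cov s) f)
    c : Fin L → ℕ
    c f = suc r ^ d * (in₀ f * (j ^ (met s f ∸ 1) * r ^ (d ∸ met s f)))
    eq₁ : ∀ a b x → a * (b * x) ≡ b * a * x
    eq₁ = solve-∀
    eq₂ : ∀ x a b y → x * a * (b * y) ≡ x * y * (a * b)
    eq₂ = solve-∀
    pointwise : ∀ i f → suc r ^ d * w i * (in′ i f * (j ^ (met (s′ i) f ∸ 1) * r ^ (d ∸ met (s′ i) f)))
                      ≤ c f * (w i * in′ i f)
    pointwise i f with lookup s i in i∈s
    ... | false = ≤-trans (≤-reflexive (cong (_* (in′ i f * (j ^ (met (s′ i) f ∸ 1) * r ^ (d ∸ met (s′ i) f)))) (*-zeroʳ (suc r ^ d)))) z≤n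
    ... | true with inside? (cov (s′ i)) f
    ...   | no _   = ≤-trans (≤-reflexive (*-zeroʳ (suc r ^ d * 1))) z≤n
    ...   | yes f⊆ rewrite 𝟙-true (inside? (cov s) f) (inside-remove⇒inside s i f i∈s f⊆)
                         | inside-remove⇒met≡ s U (suc r) i f M i∈s f⊆ =
      ≤-reflexive (eq₃ (suc r ^ d) (j ^ (met (s′ i) f ∸ 1)) (r ^ (d ∸ met (s′ i) f)))
      where
      eq₃ : ∀ a b x → a * 1 * (1 * (b * x)) ≡ a * (1 * (b * x)) * 1
      eq₃ = solve-∀
    -- Here Y counts the removals that the edge survives. Up to common powers the claim is Y/(r+1) ≤
    -- (r/(r+1))^t, which is `power-bernoulli` with x = 1.
    core : ∀ t Y → 1 ≤ t → t ≤ d → Y + t ≤ suc r →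
           suc r ^ d * r ^ (d ∸ t) * Y ≤ suc r * r ^ d * suc r ^ (d ∸ t)
    core (suc t) Y 1≤t t≤d Y+t≤ = begin
      suc r ^ d * x * Y                                 ≡⟨ cong (λ e → e * x * Y) (split (suc r)) ⟩
      z * (suc r * suc r ^ t) * x * Y                   ≡⟨ eq₄ z (suc r) (suc r ^ t) x Y ⟩
      suc r * x * z * (suc r ^ t * Y)                   ≤⟨ *-monoʳ-≤ (suc r * x * z) bern ⟩
      suc r * x * z * (r ^ t * r)                       ≡⟨ eq₅ (suc r) x z (r ^ t) r ⟩
      suc r * (x * (r * r ^ t)) * z                     ≡⟨ cong (λ e → suc r * e * z) (split r) ⟨
      suc r * r ^ d * z                                 ∎
      where
      x = r ^ (d ∸ suc t)
      z = suc r ^ (d ∸ suc t)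
      split : ∀ a → a ^ d ≡ a ^ (d ∸ suc t) * a ^ suc t
      split a = trans (cong (a ^_) (sym (m∸n+n≡m t≤d))) (^-distribˡ-+-* a (d ∸ suc t) (suc t))
      bern : suc r ^ t * Y ≤ r ^ t * r
      bern = subst (λ x → x ^ t * Y ≤ r ^ t * r) (+-comm r 1)
        (power-bernoulli r 1 t Y (subst (λ x → Y + x ≤ r) (sym (*-identityʳ t))
          (s≤s⁻¹ (subst (_≤ suc r) (+-suc Y t) Y+t≤))))
      eq₄ : ∀ z a b x y → z * (a * b) * x * y ≡ a * x * z * (b * y)
      eq₄ = solve-∀
      eq₅ : ∀ a x z b r → a * x * z * (b * r) ≡ a * (x * (r * b)) * z
      eq₅ = solve-∀
    perEdge : ∀ f → c f * survivors s f ≤ suc r * r ^ d * (in₀ f * (j ^ (met s f ∸ 1) * suc r ^ (d ∸ met s f)))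
    perEdge f = begin
      suc r ^ d * (in₀ f * (J * r ^ (d ∸ t))) * survivors s f
        ≡⟨ eq₆ (suc r ^ d) (in₀ f) J (r ^ (d ∸ t)) (survivors s f) ⟩
      in₀ f * (J * (suc r ^ d * r ^ (d ∸ t) * survivors s f))
        ≤⟨ 𝟙-guard (inside? (cov s) f) (λ f⊆ → *-monoʳ-≤ J (core t (survivors s f) (met≥1 s f f⊆) (met≤d s U (suc r) f M)
             (subst (survivors s f + t ≤_) size≡ (survivors+met≤size s U (suc r) f M)))) ⟩
      in₀ f * (J * (suc r * r ^ d * suc r ^ (d ∸ t)))
        ≡⟨ eq₇ (in₀ f) J (suc r * r ^ d) (suc r ^ (d ∸ t)) ⟩
      suc r * r ^ d * (in₀ f * (J * suc r ^ (d ∸ t))) ∎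
      where
      t = met s f
      J = j ^ (t ∸ 1)
      eq₆ : ∀ a i b x y → a * (i * (b * x)) * y ≡ i * (b * (a * x * y))
      eq₆ = solve-∀
      eq₇ : ∀ i b a x → i * (b * (a * x)) ≡ a * (i * (b * x))
      eq₇ = solve-∀

  available : (Fin n → Bool) → ℕ
  available U = ∑ λ f → 𝟙 (inside? (ι ∘ U) f)

  -- At j = r the two exponents add up to d - 1 for every edge, so the estimate becomes exact and
  -- depends on s only through U.
  p-top : ∀ s U r → Matching s U r → p r s r ≡ available U * r ^ d′
  p-top s U r M@(_ , cov≡) = trans (∑-cong perEdge) (sym (*-distribʳ-sum (r ^ d′) (λ f → 𝟙 (inside? (ι ∘ U) f))))
    where
    exponent : ∀ t → 1 ≤ t → t ≤ d → t ∸ 1 + (d ∸ t) ≡ d′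
    exponent (suc t) _ t≤d = m+[n∸m]≡n (s≤s⁻¹ t≤d)
    perEdge : ∀ f → 𝟙 (inside? (cov s) f) * (r ^ (met s f ∸ 1) * r ^ (d ∸ met s f)) ≡ 𝟙 (inside? (ι ∘ U) f) * r ^ d′
    perEdge f rewrite sym (𝟙-cong (inside? (cov s) f) (inside? (ι ∘ U) f)
                        (λ f⊆ v → subst (ι (inc f v) ≤_) (cov≡ v) (f⊆ v))
                        (λ f⊆ v → subst (ι (inc f v) ≤_) (sym (cov≡ v)) (f⊆ v)))
      with inside? (cov s) f
    ... | no _   = refl
    ... | yes f⊆ = cong (1 *_) (trans (sym (^-distribˡ-+-* r (met s f ∸ 1) (d ∸ met s f)))
                     (cong (r ^_) (exponent (met s f) (met≥1 s f f⊆) (met≤d s U r f M))))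

  P-suc : ∀ r s → P (suc r) s ≡ ∏ {r} (λ j → p (suc r) s (suc (toℕ j))) * p (suc r) s (suc r)
  P-suc r s = trans (∏-init-last {r} (λ j → p (suc r) s (suc (toℕ j))))
    (cong₂ _*_ (∏-cong {r} λ j → cong (p (suc r) s ∘ suc) (Fin.toℕ-inject₁ j)) (cong (p (suc r) s ∘ suc) (Fin.toℕ-fromℕ r)))

  P-nonZero : ∀ s r → size s ≡ r → NonZero (P r s)
  P-nonZero s zero    size≡ = _
  P-nonZero s (suc r) size≡ with size>0⇒member s (subst (1 ≤_) (sym size≡) (s≤s z≤n))
  ... | i , i∈s = >-nonZero (≤-trans (≤-reflexive (sym (trans (∏-const (suc r) 1) (^-zeroˡ (suc r)))))
                    (∏-mono {suc r} λ j → ≤-trans (term j) (term≤∑ (summand j) i)))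
    where
    summand : Fin (suc r) → Fin L → ℕ
    summand j f = 𝟙 (inside? (cov s) f) * (suc (toℕ j) ^ (met s f ∸ 1) * suc r ^ (d ∸ met s f))
    term : ∀ j → 1 ≤ summand j i
    term j rewrite 𝟙-true (inside? (cov s) i) (member-inside s i i∈s) =
      *-mono-≤ (≤-refl {1}) (*-mono-≤ (m^n>0 (suc (toℕ j)) (met s i ∸ 1)) (m^n>0 (suc r) (d ∸ met s i)))

  module Weights (Δ : ℕ) {{_ : NonZero Δ}} (Q : Vec Bool L → ℕ)
                 (QP≡Δ : ∀ s → NonZero (P (size s) s) → Q s * P (size s) s ≡ Δ) where

    -- With P(s) = P r s / r^(dr) for r = |s|, the weight of a matching s is Δ / P(s).
    weight : ℕ → Vec Bool L → ℕ
    weight r s = (r ^ d) ^ r * Q s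

    QP≡ : ∀ s U r → Matching s U r → Q s * P r s ≡ Δ
    QP≡ s U r (refl , _) = QP≡Δ s (P-nonZero s r refl)

    -- By Jensen and `p-supermartingale`, the average of 1/P over the r + 1 deletions is at least
    -- the reciprocal of the product of the lower r factors of P(s). That product lacks only the top
    -- factor, which is N/(r+1) by `p-top`; summing over the deletions cancels r + 1.
    weight-step : ∀ s U r → Matching s U (suc r) →
      available U * weight (suc r) s ≤ ∑ (λ i → ι (lookup s i) * weight r (s [ i ]≔ false))
    weight-step s U r M@(size≡ , _) = *-cancelˡ-≤ (P (suc r) s) {{P-nonZero s (suc r) size≡}} (begin
      P (suc r) s * (available U * ((ρ * ρ ^ d′) * (ρ ^ d) ^ r * Q s))
        ≡⟨ eq₁ (P (suc r) s) (available U) ρ (ρ ^ d′) ((ρ ^ d) ^ r) (Q s) ⟩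
      ρ * ((ρ ^ d) ^ r * (Q s * P (suc r) s)) * (available U * ρ ^ d′)
        ≡⟨ cong₂ (λ x y → ρ * ((ρ ^ d) ^ r * x) * y) (QP≡ s U (suc r) M) (sym (p-top s U (suc r) M)) ⟩
      ρ * ((ρ ^ d) ^ r * Δ) * top
        ≤⟨ *-monoˡ-≤ top (subst (λ x → x * ((ρ ^ d) ^ r * Δ) ≤ ∏ q * ∑ (λ i → ι (lookup s i) * Q (s′ i))) size≡
             (jensen s {{subst NonZero (sym size≡) _}} y q (Q ∘ s′) ((ρ ^ d) ^ r * Δ) Qy≡
               (λ j → subst (λ x → ∑ (λ i → ι (lookup s i) * y i j) ≤ x * q j) (sym size≡)
                        (p-supermartingale s U r (suc (toℕ j)) M)))) ⟩
      ∏ q * ∑ (λ i → ι (lookup s i) * Q (s′ i)) * top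
        ≡⟨ cong (λ x → x * ∑ (λ i → ι (lookup s i) * Q (s′ i)) * top) (∏-scale {r} (r ^ d) (λ j → p (suc r) s (suc (toℕ j)))) ⟩
      (r ^ d) ^ r * lower * ∑ (λ i → ι (lookup s i) * Q (s′ i)) * top
        ≡⟨ eq₂ ((r ^ d) ^ r) lower (∑ (λ i → ι (lookup s i) * Q (s′ i))) top ⟩
      lower * top * ((r ^ d) ^ r * ∑ (λ i → ι (lookup s i) * Q (s′ i)))
        ≡⟨ cong₂ _*_ (sym (P-suc r s)) (trans (*-distribˡ-sum ((r ^ d) ^ r) (λ i → ι (lookup s i) * Q (s′ i)))
             (∑-cong λ i → x∙yz≈y∙xz ((r ^ d) ^ r) (ι (lookup s i)) (Q (s′ i)))) ⟩
      P (suc r) s * ∑ (λ i → ι (lookup s i) * weight r (s′ i)) ∎)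
      where
      open ≤-Reasoning
      ρ = suc r
      s′ : Fin L → Vec Bool L
      s′ i = s [ i ]≔ false
      top = p (suc r) s (suc r)
      lower = ∏ {r} (λ j → p (suc r) s (suc (toℕ j)))
      y : Fin L → Fin r → ℕ
      y i j = ρ ^ d * p r (s′ i) (suc (toℕ j))
      q : Fin r → ℕ
      q j = r ^ d * p (suc r) s (suc (toℕ j))
      eq₁ : ∀ P N ρ x y Q → P * (N * (ρ * x * y * Q)) ≡ ρ * (y * (Q * P)) * (N * x)
      eq₁ = solve-∀
      eq₂ : ∀ a b x t → a * b * x * t ≡ b * t * (a * x)
      eq₂ = solve-∀
      Qy≡ : ∀ i → lookup s i ≡ true → Q (s′ i) * ∏ (y i) ≡ (ρ ^ d) ^ r * Δ
      Qy≡ i i∈s = trans (cong (Q (s′ i) *_) (∏-scale {r} (ρ ^ d) (λ j → p r (s′ i) (suc (toℕ j)))))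
        (trans (x∙yz≈y∙xz (Q (s′ i)) ((ρ ^ d) ^ r) (P r (s′ i)))
          (cong ((ρ ^ d) ^ r *_) (QP≡ (s′ i) (λ v → U v ∧ not (inc i v)) r (matching-remove s U r i M i∈s))))

    -- Grouping the pairs (s, i) by the deleted edge i gives N times the total as at most the sum,
    -- over the N edges inside U, of the totals for U without i, each at most Δ.
    total-weight : ∀ r U → ∑ˢ (λ s → 𝟙 (matching? s U r) * weight r s) ≤ Δ
    total-weight zero U = begin
      ∑ˢ (λ s → 𝟙 (matching? s U 0) * weight 0 s)
        ≤⟨ ∑ˢ-mono (λ s → *-monoˡ-≤ (weight 0 s) (𝟙-mono (matching? s U 0) (size s ≟ 0) proj₁)) ⟩
      ∑ˢ (λ s → 𝟙 (size s ≟ 0) * weight 0 s)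
        ≤⟨ ∑ˢ-empty (weight 0) ⟩
      weight 0 ∅
        ≡⟨ trans (+-identityʳ (Q ∅)) (sym (*-identityʳ (Q ∅))) ⟩
      Q ∅ * P 0 ∅
        ≡⟨ subst (λ r → Q ∅ * P r ∅ ≡ Δ) (size-∅ L) (QP≡Δ ∅ (P-nonZero ∅ (size ∅) refl)) ⟩
      Δ ∎
      where
      open ≤-Reasoning
      ∅ = replicate L false
      size-∅ : ∀ L → size (replicate L false) ≡ 0
      size-∅ zero    = refl
      size-∅ (suc L) = size-∅ L
    total-weight (suc r) U with available U in N≡
    -- Without an available edge the sum is empty, since any member of a matching of U is itself
    -- available.
    ... | zero = ≤-trans (≤-reflexive (∑ˢ-zero _ none)) z≤n
      where
      none : ∀ s → 𝟙 (matching? s U (suc r)) * weight (suc r) s ≡ 0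
      none s with matching? s U (suc r)
      ... | no _ = refl
      ... | yes (size≡ , cov≡) with size>0⇒member s (subst (1 ≤_) (sym size≡) (s≤s z≤n))
      ...   | i , i∈s = contradiction (subst₂ _≤_
                (𝟙-true (inside? (ι ∘ U) i) (λ v → subst (ι (inc i v) ≤_) (cov≡ v) (member-inside s i i∈s v)))
                N≡ (term≤∑ (λ f → 𝟙 (inside? (ι ∘ U) f)) i)) λ ()
    ... | N@(suc _) = *-cancelˡ-≤ N (begin
      N * ∑ˢ (λ s → 𝟙 (matching? s U (suc r)) * weight (suc r) s)
        ≡⟨ *-distribˡ-∑ˢ N (λ s → 𝟙 (matching? s U (suc r)) * weight (suc r) s) ⟩
      ∑ˢ (λ s → N * (𝟙 (matching? s U (suc r)) * weight (suc r) s))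
        ≤⟨ ∑ˢ-mono (λ s → ≤-trans (≤-reflexive (x∙yz≈y∙xz N (𝟙 (matching? s U (suc r))) (weight (suc r) s)))
             (𝟙-guard (matching? s U (suc r)) (λ M →
               subst (λ N → N * weight (suc r) s ≤ ∑ (λ i → ι (lookup s i) * weight r (s [ i ]≔ false))) N≡ (weight-step s U r M)))) ⟩
      ∑ˢ (λ s → 𝟙 (matching? s U (suc r)) * ∑ (λ i → ι (lookup s i) * weight r (s [ i ]≔ false)))
        ≡⟨ ∑ˢ-cong (λ s → *-distribˡ-sum (𝟙 (matching? s U (suc r))) (λ i → ι (lookup s i) * weight r (s [ i ]≔ false))) ⟩
      ∑ˢ (λ s → ∑ λ i → 𝟙 (matching? s U (suc r)) * (ι (lookup s i) * weight r (s [ i ]≔ false)))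
        ≤⟨ ∑ˢ-mono (λ s → ∑-mono λ i → pointwise s i) ⟩
      ∑ˢ (λ s → ∑ λ i → in₀ i * (ι (lookup s i) * h i (s [ i ]≔ false)))
        ≡⟨ ∑ˢ-∑-comm (λ s i → in₀ i * (ι (lookup s i) * h i (s [ i ]≔ false))) ⟩
      ∑ (λ i → ∑ˢ λ s → in₀ i * (ι (lookup s i) * h i (s [ i ]≔ false)))
        ≡⟨ ∑-cong (λ i → *-distribˡ-∑ˢ (in₀ i) (λ s → ι (lookup s i) * h i (s [ i ]≔ false))) ⟨
      ∑ (λ i → in₀ i * ∑ˢ λ s → ι (lookup s i) * h i (s [ i ]≔ false))
        ≤⟨ ∑-mono (λ i → *-monoʳ-≤ (in₀ i) (≤-trans (∑ˢ-remove (h i) i) (total-weight r (U∖ i)))) ⟩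
      ∑ (λ i → in₀ i * Δ)
        ≡⟨ trans (sym (*-distribʳ-sum Δ in₀)) (cong (_* Δ) N≡) ⟩
      N * Δ ∎)
      where
      open ≤-Reasoning
      in₀ : Fin L → ℕ
      in₀ i = 𝟙 (inside? (ι ∘ U) i)
      U∖ : Fin L → Fin n → Bool
      U∖ i v = U v ∧ not (inc i v)
      h : Fin L → Vec Bool L → ℕ
      h i s = 𝟙 (matching? s (U∖ i) r) * weight r s
      pointwise : ∀ s i → 𝟙 (matching? s U (suc r)) * (ι (lookup s i) * weight r (s [ i ]≔ false))
                        ≤ in₀ i * (ι (lookup s i) * h i (s [ i ]≔ false))
      pointwise s i with lookup s i in i∈s | matching? s U (suc r)
      ... | false | M? = ≤-trans (≤-reflexive (*-zeroʳ (𝟙 M?))) z≤n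
      ... | true  | no _ = z≤n
      ... | true  | yes M@(_ , cov≡)
        rewrite 𝟙-true (inside? (ι ∘ U) i) (λ v → subst (ι (inc i v) ≤_) (cov≡ v) (member-inside s i i∈s v))
              | 𝟙-true (matching? (s [ i ]≔ false) (U∖ i) r) (matching-remove s U r i M i∈s) =
        ≤-reflexive (cong (λ x → 1 * (1 * x)) (sym (+-identityʳ (weight r (s [ i ]≔ false)))))

  -- A common upper bound top/c for P bounds every weight from below, and the total weight then
  -- limits the number of matchings.
  matchings-bound : ∀ U r c top → (∀ s → Matching s U r → c * P r s ≤ top) →
                    c * ((r ^ d) ^ r * ∑ˢ (λ s → 𝟙 (matching? s U r))) ≤ top
  matchings-bound U r c top cP≤top with commonMultiple (λ s → P (size s) s)
  ... | Δ , Δ≢0 , Q , QP≡Δ = *-cancelˡ-≤ Δ {{Δ≢0}} (begin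
    Δ * (c * (x * ∑ˢ χ))
      ≡⟨ eq₁ Δ c x (∑ˢ χ) ⟩
    Δ * c * x * ∑ˢ χ
      ≡⟨ *-distribˡ-∑ˢ (Δ * c * x) χ ⟩
    ∑ˢ (λ s → Δ * c * x * χ s)
      ≤⟨ ∑ˢ-mono pointwise ⟩
    ∑ˢ (λ s → top * (χ s * weight r s))
      ≡⟨ *-distribˡ-∑ˢ top (λ s → χ s * weight r s) ⟨
    top * ∑ˢ (λ s → χ s * weight r s)
      ≤⟨ *-monoʳ-≤ top (total-weight r U) ⟩
    top * Δ
      ≡⟨ *-comm top Δ ⟩
    Δ * top ∎)
    where
    open ≤-Reasoning
    open Weights Δ {{Δ≢0}} Q QP≡Δ
    x = (r ^ d) ^ r
    χ : Vec Bool L → ℕ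
    χ s = 𝟙 (matching? s U r)
    eq₁ : ∀ a b c d → a * (b * (c * d)) ≡ a * b * c * d
    eq₁ = solve-∀
    eq₂ : ∀ Q P c x → Q * P * c * x ≡ c * P * (x * Q)
    eq₂ = solve-∀
    pointwise : ∀ s → Δ * c * x * χ s ≤ top * (χ s * weight r s)
    pointwise s = begin
      Δ * c * x * χ s               ≡⟨ *-comm (Δ * c * x) (χ s) ⟩
      χ s * (Δ * c * x)             ≤⟨ 𝟙-guard (matching? s U r) (λ m → begin
        Δ * c * x                     ≡⟨ cong (λ e → e * c * x) (QP≡ s U r m) ⟨
        Q s * P r s * c * x           ≡⟨ eq₂ (Q s) (P r s) c x ⟩
        c * P r s * weight r s        ≤⟨ *-monoˡ-≤ (weight r s) (cP≤top s m) ⟩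
        top * weight r s              ∎) ⟩
      χ s * (top * weight r s)      ≡⟨ x∙yz≈y∙xz (χ s) top (weight r s) ⟩
      top * (χ s * weight r s)      ∎

-- Edges meeting a perfect matching

δ≢ : ∀ {n} → Fin n → Fin n → ℕ
δ≢ u v = ι (not (does (u Fin.≟ v)))

-- For a 0/1-valued `g` with sum x this is x(x - 1), kept as a sum over ordered pairs of vertices so
-- that summing over edges produces codegrees.
pairs : ∀ {n} → (Fin n → ℕ) → ℕ
pairs g = ∑ λ u → g u * ∑ λ v → δ≢ u v * g v

-- It says x ≤ 1 + x(x - 1) for x ≥ 1. In the induction, the pairs through the first vertex with
-- value 1 pay for all later ones.
∑≤1⊓∑+pairs : ∀ {n} (g : Fin n → ℕ) → (∀ v → g v ≤ 1) → ∑ g ≤ 1 ⊓ ∑ g + pairs g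
∑≤1⊓∑+pairs {zero}  g g≤1 = z≤n
∑≤1⊓∑+pairs {suc n} g g≤1 = begin
  g zero + x                              ≤⟨ go (g zero) (g≤1 zero) ⟩
  1 ⊓ (g zero + x) + (g zero * x + pairs (g ∘ suc))
    ≤⟨ +-monoʳ-≤ (1 ⊓ (g zero + x)) (+-mono-≤
         (*-monoʳ-≤ (g zero) (≤-reflexive (∑-cong λ v → sym (*-identityˡ (g (suc v))))))
         (∑-mono λ u → *-monoʳ-≤ (g (suc u)) (m≤n+m _ (1 * g zero)))) ⟩
  1 ⊓ (g zero + x) + pairs g ∎
  where
  open ≤-Reasoning
  x = ∑ (g ∘ suc)
  go : ∀ y → y ≤ 1 → y + x ≤ 1 ⊓ (y + x) + (y * x + pairs (g ∘ suc))
  go zero          _ = ∑≤1⊓∑+pairs (g ∘ suc) (g≤1 ∘ suc)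
  go (suc zero)    _ = s≤s (≤-trans (≤-reflexive (sym (+-identityʳ x))) (m≤m+n (x + 0) (pairs (g ∘ suc))))
  go (suc (suc _)) (s≤s ())

a^e+b^e≤[a+b]^e : ∀ a b e .{{_ : NonZero e}} → a ^ e + b ^ e ≤ (a + b) ^ e
a^e+b^e≤[a+b]^e a b (suc e) = ≤-trans
  (+-mono-≤ (*-monoʳ-≤ a (^-monoˡ-≤ e (m≤m+n a b))) (*-monoʳ-≤ b (^-monoˡ-≤ e (m≤n+m b a))))
  (≤-reflexive (sym (*-distribʳ-+ ((a + b) ^ e) a b)))

module PerfectMatchings {L n : ℕ} (inc : Fin L → Fin n → Bool) (d′ : ℕ)
                 (uniform : ∀ i → ∑ (λ v → ι (inc i v)) ≡ suc d′) where
  open Matchings inc d′ uniform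

  common : Fin L → Fin L → Fin n → ℕ
  common f i v = ι (inc f v) * ι (inc i v)

  -- Dominates the defect d - t of an available edge by an expression linear in codegrees after
  -- summation over f.
  bad : Vec Bool L → Fin L → ℕ
  bad s f = ∑ λ i → ι (lookup s i) * pairs (common f i)

  d≤met+bad : ∀ s f → Inside (cov s) f → d ≤ met s f + bad s f
  d≤met+bad s f f⊆s = begin
    d                                                                   ≤⟨ inside⇒d≤∑meet s f f⊆s ⟩
    ∑ (λ i → w i * meet f i)                                            ≤⟨ ∑-mono (λ i → *-monoʳ-≤ (w i) (∑≤1⊓∑+pairs (common f i) (λ v → *-mono-≤ (ι≤1 (inc f v)) (ι≤1 (inc i v))))) ⟩
    ∑ (λ i → w i * (1 ⊓ meet f i + pairs (common f i)))                 ≡⟨ ∑-cong (λ i → *-distribˡ-+ (w i) (1 ⊓ meet f i) (pairs (common f i))) ⟩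
    ∑ (λ i → w i * (1 ⊓ meet f i) + w i * pairs (common f i))           ≡⟨ ∑-distrib-+ (λ i → w i * (1 ⊓ meet f i)) (λ i → w i * pairs (common f i)) ⟩
    met s f + bad s f                                                   ∎
    where
    open ≤-Reasoning
    w : Fin L → ℕ
    w i = ι (lookup s i)

  -- Edges with t = d contribute j^(d-1). The others have `bad` at least 1, and as j ≤ r each
  -- contributes at most r^(d-1).
  p≤ : ∀ s U r j → Matching s U r → j ≤ r → p r s j ≤ L * j ^ d′ + ∑ (bad s) * r ^ d′
  p≤ s U r j M j≤r = begin
    p r s j                                             ≤⟨ ∑-mono perEdge ⟩
    ∑ (λ f → j ^ d′ + bad s f * r ^ d′)                 ≡⟨ ∑-distrib-+ (λ _ → j ^ d′) (λ f → bad s f * r ^ d′) ⟩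
    ∑ {L} (λ _ → j ^ d′) + ∑ (λ f → bad s f * r ^ d′)   ≡⟨ cong₂ _+_ (∑-const L (j ^ d′)) (sym (*-distribʳ-sum (r ^ d′) (bad s))) ⟩
    L * j ^ d′ + ∑ (bad s) * r ^ d′                     ∎
    where
    open ≤-Reasoning
    core : ∀ t b → 1 ≤ t → t ≤ d → d ≤ t + b → j ^ (t ∸ 1) * r ^ (d ∸ t) ≤ j ^ d′ + b * r ^ d′
    core (suc t) zero _ t≤d d≤t+0 with refl ← suc-injective (≤-antisym t≤d (≤-trans d≤t+0 (≤-reflexive (+-identityʳ (suc t))))) =
      ≤-reflexive (trans (cong (λ e → j ^ t * r ^ e) (n∸n≡0 t)) (trans (*-identityʳ (j ^ t)) (sym (+-identityʳ (j ^ t)))))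
    core (suc t) (suc b) _ t≤d _ = begin
      j ^ t * r ^ (d′ ∸ t)         ≤⟨ *-monoˡ-≤ (r ^ (d′ ∸ t)) (^-monoˡ-≤ t j≤r) ⟩
      r ^ t * r ^ (d′ ∸ t)         ≡⟨ ^-distribˡ-+-* r t (d′ ∸ t) ⟨
      r ^ (t + (d′ ∸ t))           ≡⟨ cong (r ^_) (m+[n∸m]≡n (s≤s⁻¹ t≤d)) ⟩
      r ^ d′                       ≤⟨ m≤m+n (r ^ d′) (b * r ^ d′) ⟩
      suc b * r ^ d′               ≤⟨ m≤n+m _ (j ^ d′) ⟩
      j ^ d′ + suc b * r ^ d′      ∎
    perEdge : ∀ f → 𝟙 (inside? (cov s) f) * (j ^ (met s f ∸ 1) * r ^ (d ∸ met s f)) ≤ j ^ d′ + bad s f * r ^ d′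
    perEdge f with inside? (cov s) f
    ... | no _   = z≤n
    ... | yes f⊆ = ≤-trans (≤-reflexive (+-identityʳ _))
                     (core (met s f) (bad s f) (met≥1 s f f⊆) (met≤d s U r f M) (d≤met+bad s f f⊆))

  -- Sum over f first: each member of s holds fewer than d² ordered pairs of distinct vertices, and
  -- each pair lies in at most k/c edges.
  ∑bad≤ : ∀ s c k → (∀ u v → u ≢ v → c * ∑ (λ f → ι (inc f u) * ι (inc f v)) ≤ k) →
          c * ∑ (bad s) ≤ size s * (d * d * k)
  ∑bad≤ s c k codeg≤ = begin
    c * ∑ (bad s)
      ≡⟨ cong (c *_) (∑-comm (λ f i → w i * pairs (common f i))) ⟩
    c * ∑ (λ i → ∑ λ f → w i * pairs (common f i))
      ≡⟨ *-distribˡ-sum c (λ i → ∑ λ f → w i * pairs (common f i)) ⟩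
    ∑ (λ i → c * ∑ λ f → w i * pairs (common f i))
      ≡⟨ ∑-cong (λ i → trans (cong (c *_) (sym (*-distribˡ-sum (w i) (λ f → pairs (common f i))))) (x∙yz≈y∙xz c (w i) _)) ⟩
    ∑ (λ i → w i * (c * ∑ λ f → pairs (common f i)))
      ≤⟨ ∑-mono (λ i → *-monoʳ-≤ (w i) (perMember i)) ⟩
    ∑ (λ i → w i * (d * d * k))
      ≡⟨ *-distribʳ-sum (d * d * k) w ⟨
    size s * (d * d * k) ∎
    where
    open ≤-Reasoning
    w : Fin L → ℕ
    w i = ι (lookup s i)
    perMember : ∀ i → c * ∑ (λ f → pairs (common f i)) ≤ d * d * k
    perMember i = begin
      c * ∑ (λ f → ∑ λ u → common f i u * ∑ λ v → δ≢ u v * common f i v)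
        ≡⟨ cong (c *_) (trans (∑-comm (λ f u → common f i u * ∑ λ v → δ≢ u v * common f i v))
             (∑-cong λ u → trans (∑-cong λ f → *-distribˡ-sum (common f i u) (λ v → δ≢ u v * common f i v))
               (∑-comm (λ f v → common f i u * (δ≢ u v * common f i v))))) ⟩
      c * ∑ (λ u → ∑ λ v → ∑ λ f → common f i u * (δ≢ u v * common f i v))
        ≡⟨ trans (*-distribˡ-sum c (λ u → ∑ λ v → ∑ λ f → common f i u * (δ≢ u v * common f i v)))
             (∑-cong λ u → *-distribˡ-sum c (λ v → ∑ λ f → common f i u * (δ≢ u v * common f i v))) ⟩
      ∑ (λ u → ∑ λ v → c * ∑ λ f → common f i u * (δ≢ u v * common f i v))
        ≤⟨ ∑-mono (λ u → ∑-mono λ v → perPair u v) ⟩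
      ∑ (λ u → ∑ λ v → ι (inc i u) * (ι (inc i v) * k))
        ≡⟨ ∑-cong (λ u → trans (cong (ι (inc i u) *_) (trans (cong (_* k) (sym (uniform i))) (*-distribʳ-sum k (λ v → ι (inc i v)))))
             (*-distribˡ-sum (ι (inc i u)) (λ v → ι (inc i v) * k))) ⟨
      ∑ (λ u → ι (inc i u) * (d * k))
        ≡⟨ trans (sym (*-distribʳ-sum (d * k) (λ u → ι (inc i u)))) (cong (_* (d * k)) (uniform i)) ⟩
      d * (d * k)
        ≡⟨ *-assoc d d k ⟨
      d * d * k ∎
      where
      regroup : ∀ a b c e x → a * b * (x * (c * e)) ≡ b * e * x * (a * c)
      regroup = solve-∀
      factor : ∀ u v → c * ∑ (λ f → common f i u * (δ≢ u v * common f i v))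
                     ≡ ι (inc i u) * (ι (inc i v) * (δ≢ u v * (c * ∑ (λ f → ι (inc f u) * ι (inc f v)))))
      factor u v = trans (cong (c *_) (trans (∑-cong λ f → regroup (ι (inc f u)) (ι (inc i u)) (ι (inc f v)) (ι (inc i v)) (δ≢ u v))
          (sym (*-distribˡ-sum (ι (inc i u) * ι (inc i v) * δ≢ u v) (λ f → ι (inc f u) * ι (inc f v))))))
        (eq c (ι (inc i u)) (ι (inc i v)) (δ≢ u v) _)
        where
        eq : ∀ c a b x y → c * (a * b * x * y) ≡ a * (b * (x * (c * y)))
        eq = solve-∀
      perPair : ∀ u v → c * ∑ (λ f → common f i u * (δ≢ u v * common f i v)) ≤ ι (inc i u) * (ι (inc i v) * k)
      perPair u v = ≤-trans (≤-reflexive (factor u v)) (*-monoʳ-≤ (ι (inc i u)) (*-monoʳ-≤ (ι (inc i v)) distinct≤))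
        where
        distinct≤ : δ≢ u v * (c * ∑ (λ f → ι (inc f u) * ι (inc f v))) ≤ k
        distinct≤ with u Fin.≟ v
        ... | yes _  = z≤n
        ... | no u≢v = ≤-trans (≤-reflexive (+-identityʳ _)) (codeg≤ u v u≢v)

  covering⇒n≡size*d : ∀ s → (∀ v → cov s v ≡ 1) → n ≡ size s * d
  covering⇒n≡size*d s cov≡1 = begin
    n                                                        ≡⟨ *-identityʳ n ⟨
    n * 1                                                    ≡⟨ ∑-const n 1 ⟨
    ∑ {n} (λ _ → 1)                                          ≡⟨ ∑-cong cov≡1 ⟨
    ∑ (cov s)                                                ≡⟨ ∑-comm (λ v i → ι (lookup s i) * ι (inc i v)) ⟩
    ∑ (λ i → ∑ λ v → ι (lookup s i) * ι (inc i v))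
      ≡⟨ ∑-cong (λ i → trans (sym (*-distribˡ-sum (ι (lookup s i)) (λ v → ι (inc i v)))) (cong (ι (lookup s i) *_) (uniform i))) ⟩
    ∑ (λ i → ι (lookup s i) * d)                             ≡⟨ *-distribʳ-sum d (λ i → ι (lookup s i)) ⟨
    size s * d                                               ∎
    where open ≡-Reasoning

  edges-count : ∀ k m → (∀ v → ∑ (λ f → ι (inc f v)) ≡ k) → n ≡ m * d → L ≡ m * k
  edges-count k m regular n≡ = *-cancelʳ-≡ L (m * k) d (begin
    L * d                               ≡⟨ ∑-const L d ⟨
    ∑ {L} (λ _ → d)                     ≡⟨ ∑-cong uniform ⟨
    ∑ (λ f → ∑ λ v → ι (inc f v))       ≡⟨ ∑-comm (λ f v → ι (inc f v)) ⟩
    ∑ (λ v → ∑ λ f → ι (inc f v))       ≡⟨ ∑-cong regular ⟩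
    ∑ {n} (λ _ → k)                     ≡⟨ ∑-const n k ⟩
    n * k                               ≡⟨ cong (_* k) n≡ ⟩
    m * d * k                           ≡⟨ eq m d k ⟩
    m * k * d                           ∎)
    where
    open ≡-Reasoning
    eq : ∀ a b c → a * b * c ≡ a * c * b
    eq = solve-∀

  full : Fin n → Bool
  full _ = true

  module Bound .{{_ : NonZero d′}} (k m T : ℕ) .{{_ : NonZero m}} .{{_ : NonZero T}}
               (regular : ∀ v → ∑ (λ f → ι (inc f v)) ≡ k) (n≡md : n ≡ m * d)
               (codeg≤ : ∀ u v → u ≢ v → T ^ d′ * (d * d) * ∑ (λ f → ι (inc f u) * ι (inc f v)) ≤ k) where

    T^d′*∑bad≤ : ∀ s → Matching s full m → T ^ d′ * ∑ (bad s) ≤ m * k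
    T^d′*∑bad≤ s (size≡ , _) = *-cancelʳ-≤ _ _ (d * d) (begin
      T ^ d′ * ∑ (bad s) * (d * d)     ≡⟨ eq₁ (T ^ d′) (∑ (bad s)) (d * d) ⟩
      T ^ d′ * (d * d) * ∑ (bad s)     ≤⟨ ∑bad≤ s (T ^ d′ * (d * d)) k codeg≤ ⟩
      size s * (d * d * k)             ≡⟨ cong (_* (d * d * k)) size≡ ⟩
      m * (d * d * k)                  ≡⟨ eq₂ m (d * d) k ⟩
      m * k * (d * d)                  ∎)
      where
      open ≤-Reasoning
      eq₁ : ∀ a b c → a * b * c ≡ a * c * b
      eq₁ = solve-∀
      eq₂ : ∀ a b c → a * (b * c) ≡ a * c * b
      eq₂ = solve-∀

    -- The codegree hypothesis is tuned so that the bad edges add (m/T)^(d-1) to j^(d-1). Merging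
    -- the two into (j + m/T)^(d-1) makes the product over j a (d-1)-th power.
    scaled-p≤ : ∀ s j → Matching s full m → j ≤ m → T ^ d′ * p m s j ≤ m * k * (T * j + m) ^ d′
    scaled-p≤ s j M j≤m = begin
      T ^ d′ * p m s j
        ≤⟨ *-monoʳ-≤ (T ^ d′) (p≤ s full m j M j≤m) ⟩
      T ^ d′ * (L * j ^ d′ + ∑ (bad s) * m ^ d′)
        ≡⟨ cong (λ L → T ^ d′ * (L * j ^ d′ + ∑ (bad s) * m ^ d′)) (edges-count k m regular n≡md) ⟩
      T ^ d′ * (m * k * j ^ d′ + ∑ (bad s) * m ^ d′)
        ≡⟨ eq (T ^ d′) (m * k) (j ^ d′) (∑ (bad s)) (m ^ d′) ⟩
      m * k * (T ^ d′ * j ^ d′) + T ^ d′ * ∑ (bad s) * m ^ d′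
        ≤⟨ +-monoʳ-≤ (m * k * (T ^ d′ * j ^ d′)) (*-monoˡ-≤ (m ^ d′) (T^d′*∑bad≤ s M)) ⟩
      m * k * (T ^ d′ * j ^ d′) + m * k * m ^ d′
        ≡⟨ trans (cong (λ x → m * k * x + m * k * m ^ d′) (sym (^-distribʳ-* d′ T j)))
             (sym (*-distribˡ-+ (m * k) ((T * j) ^ d′) (m ^ d′))) ⟩
      m * k * ((T * j) ^ d′ + m ^ d′)
        ≤⟨ *-monoʳ-≤ (m * k) (a^e+b^e≤[a+b]^e (T * j) m d′) ⟩
      m * k * (T * j + m) ^ d′ ∎
      where
      open ≤-Reasoning
      eq : ∀ t x y b z → t * (x * y + b * z) ≡ x * (t * y) + t * b * z
      eq = solve-∀

    Π : ℕ
    Π = ∏ {m} λ j → T * suc (toℕ j) + m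

    scaled-P≤ : ∀ s → Matching s full m → (T ^ d′) ^ m * P m s ≤ (m * k) ^ m * Π ^ d′
    scaled-P≤ s M = begin
      (T ^ d′) ^ m * P m s
        ≡⟨ ∏-scale {m} (T ^ d′) (λ j → p m s (suc (toℕ j))) ⟨
      ∏ {m} (λ j → T ^ d′ * p m s (suc (toℕ j)))
        ≤⟨ ∏-mono {m} (λ j → scaled-p≤ s (suc (toℕ j)) M (Fin.toℕ<n j)) ⟩
      ∏ {m} (λ j → m * k * (T * suc (toℕ j) + m) ^ d′)
        ≡⟨ ∏-scale {m} (m * k) (λ j → (T * suc (toℕ j) + m) ^ d′) ⟩
      (m * k) ^ m * ∏ {m} (λ j → (T * suc (toℕ j) + m) ^ d′)
        ≡⟨ cong ((m * k) ^ m *_) (∏-^ {m} (λ j → T * suc (toℕ j) + m) d′) ⟨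
      (m * k) ^ m * Π ^ d′ ∎
      where open ≤-Reasoning

    -- After cancellation the bound on the count is k^m (Π/(mT)^m)^(d-1), and Π/(mT)^m is at most
    -- (b/a)^m.
    count≤ : ∀ a b → a ^ m * Π ≤ b ^ m * (m * T) ^ m →
             ∑ˢ (λ s → 𝟙 (matching? s full m)) * (a ^ m) ^ d′ ≤ k ^ m * (b ^ m) ^ d′
    count≤ a b aΠ≤ = *-cancelˡ-≤ ((T ^ d′) ^ m * (m ^ d) ^ m) {{nz}} (begin
      (T ^ d′) ^ m * (m ^ d) ^ m * (N * (a ^ m) ^ d′)
        ≡⟨ eq₁ ((T ^ d′) ^ m) ((m ^ d) ^ m) N ((a ^ m) ^ d′) ⟩
      (T ^ d′) ^ m * ((m ^ d) ^ m * N) * (a ^ m) ^ d′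
        ≤⟨ *-monoˡ-≤ ((a ^ m) ^ d′) (matchings-bound full m ((T ^ d′) ^ m) ((m * k) ^ m * Π ^ d′) scaled-P≤) ⟩
      (m * k) ^ m * Π ^ d′ * (a ^ m) ^ d′
        ≡⟨ trans (eq₂ ((m * k) ^ m) (Π ^ d′) ((a ^ m) ^ d′)) (cong ((m * k) ^ m *_) (sym (^-distribʳ-* d′ (a ^ m) Π))) ⟩
      (m * k) ^ m * (a ^ m * Π) ^ d′
        ≤⟨ *-monoʳ-≤ ((m * k) ^ m) (^-monoˡ-≤ d′ aΠ≤) ⟩
      (m * k) ^ m * (b ^ m * (m * T) ^ m) ^ d′
        ≡⟨ cong₂ _*_ (^-distribʳ-* m m k) (trans (^-distribʳ-* d′ (b ^ m) ((m * T) ^ m))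
             (cong ((b ^ m) ^ d′ *_) (trans (exchange (m * T)) (trans (cong (_^ m) (^-distribʳ-* d′ m T)) (^-distribʳ-* m (m ^ d′) (T ^ d′)))))) ⟩
      m ^ m * k ^ m * ((b ^ m) ^ d′ * ((m ^ d′) ^ m * (T ^ d′) ^ m))
        ≡⟨ eq₃ (m ^ m) (k ^ m) ((b ^ m) ^ d′) ((m ^ d′) ^ m) ((T ^ d′) ^ m) ⟩
      (T ^ d′) ^ m * (m ^ m * (m ^ d′) ^ m) * (k ^ m * (b ^ m) ^ d′)
        ≡⟨ cong (λ x → (T ^ d′) ^ m * x * (k ^ m * (b ^ m) ^ d′)) (^-distribʳ-* m m (m ^ d′)) ⟨
      (T ^ d′) ^ m * (m ^ d) ^ m * (k ^ m * (b ^ m) ^ d′) ∎)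
      where
      open ≤-Reasoning
      N = ∑ˢ (λ s → 𝟙 (matching? s full m))
      nz : NonZero ((T ^ d′) ^ m * (m ^ d) ^ m)
      nz = m*n≢0 _ _ {{m^n≢0 (T ^ d′) m {{m^n≢0 T d′}}}} {{m^n≢0 (m ^ d) m {{m^n≢0 m d}}}}
      exchange : ∀ x → (x ^ m) ^ d′ ≡ (x ^ d′) ^ m
      exchange x = trans (^-*-assoc x m d′) (trans (cong (x ^_) (*-comm m d′)) (sym (^-*-assoc x d′ m)))
      eq₁ : ∀ t x N a → t * x * (N * a) ≡ t * (x * N) * a
      eq₁ = solve-∀
      eq₂ : ∀ x y z → x * y * z ≡ x * (z * y)
      eq₂ = solve-∀
      eq₃ : ∀ x k b y t → x * k * (b * (y * t)) ≡ t * (x * y) * (k * b)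
      eq₃ = solve-∀

-- From hypergraphs to incidence functions

length-filterᵇ : ∀ {A : Set} (q : A → Bool) xs → length (filterᵇ q xs) ≡ ∑ (λ i → ι (q (List.lookup xs i)))
length-filterᵇ q []       = refl
length-filterᵇ q (x ∷ xs) with q x
... | true  = cong suc (length-filterᵇ q xs)
... | false = length-filterᵇ q xs

length-filterᵇ-map : ∀ {A B : Set} (g : A → B) (q : B → Bool) xs →
                     length (filterᵇ q (map g xs)) ≡ length (filterᵇ (q ∘ g) xs)
length-filterᵇ-map g q []       = refl
length-filterᵇ-map g q (x ∷ xs) with q (g x)
... | true  = cong suc (length-filterᵇ-map g q xs)
... | false = length-filterᵇ-map g q xs

count-allSelections : ∀ m (q : Vec Bool m → Bool) → length (filterᵇ q (allSelections m)) ≡ ∑ˢ (ι ∘ q)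
count-allSelections zero q with q []
... | true  = refl
... | false = refl
count-allSelections (suc m) q = begin
  length (filterᵇ q (map (true ∷_) (allSelections m) ++ map (false ∷_) (allSelections m)))
    ≡⟨ cong length (filter-++ (T? ∘ q) (map (true ∷_) (allSelections m)) (map (false ∷_) (allSelections m))) ⟩
  length (filterᵇ q (map (true ∷_) (allSelections m)) ++ filterᵇ q (map (false ∷_) (allSelections m)))
    ≡⟨ length-++ (filterᵇ q (map (true ∷_) (allSelections m))) ⟩
  length (filterᵇ q (map (true ∷_) (allSelections m))) + length (filterᵇ q (map (false ∷_) (allSelections m)))
    ≡⟨ cong₂ _+_ (trans (length-filterᵇ-map (true ∷_) q (allSelections m)) (count-allSelections m (q ∘ (true ∷_))))
                 (trans (length-filterᵇ-map (false ∷_) q (allSelections m)) (count-allSelections m (q ∘ (false ∷_)))) ⟩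
  ∑ˢ (ι ∘ q) ∎
  where open ≡-Reasoning

∣∣≡∑ : ∀ {n} (e : Subset n) → ∣ e ∣ ≡ ∑ (λ v → ι (lookup e v))
∣∣≡∑ []          = refl
∣∣≡∑ (true ∷ e)  = cong suc (∣∣≡∑ e)
∣∣≡∑ (false ∷ e) = ∣∣≡∑ e

ι-∧ : ∀ a b → ι (a ∧ b) ≡ ι a * ι b
ι-∧ true  b = sym (+-identityʳ (ι b))
ι-∧ false b = refl

multiplicity : ∀ {n} → Fin n → List (Subset n) → ℕ
multiplicity v []       = 0
multiplicity v (e ∷ es) = ι (lookup e v) + multiplicity v es

multiplicity-select : ∀ {n} v (es : List (Subset n)) s →
  ∑ (λ i → ι (lookup s i) * ι (lookup (List.lookup es i) v)) ≡ multiplicity v (select es s)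
multiplicity-select v []       []          = refl
multiplicity-select v (e ∷ es) (true ∷ s)  = cong₂ _+_ (+-identityʳ _) (multiplicity-select v es s)
multiplicity-select v (e ∷ es) (false ∷ s) = multiplicity-select v es s

any⇒multiplicity≥1 : ∀ {n} (v : Fin n) {es} → Any (λ e → T (lookup e v)) es → 1 ≤ multiplicity v es
any⇒multiplicity≥1 v (here {x = e} v∈e) rewrite Equivalence.to (T-≡ {lookup e v}) v∈e = s≤s z≤n
any⇒multiplicity≥1 v (there v∈es) = ≤-trans (any⇒multiplicity≥1 v v∈es) (m≤n+m _ _)

common-vertex⇒∣∩∣≥1 : ∀ {n} (e f : Subset n) v → lookup e v ≡ true → lookup f v ≡ true → 1 ≤ ∣ e ∩ f ∣
common-vertex⇒∣∩∣≥1 (true ∷ e) (true ∷ f) zero refl refl = s≤s z≤n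
common-vertex⇒∣∩∣≥1 (a ∷ e) (b ∷ f) (suc v) v∈e v∈f with a ∧ b
... | true  = s≤s z≤n
... | false = common-vertex⇒∣∩∣≥1 e f v v∈e v∈f

disjoint⇒multiplicity≡0 : ∀ {n} (v : Fin n) e {es} → lookup e v ≡ true → All (λ f → T (disjointᵇ e f)) es →
                          multiplicity v es ≡ 0
disjoint⇒multiplicity≡0 v e v∈e []                 = refl
disjoint⇒multiplicity≡0 v e v∈e (_∷_ {x = f} d ds) with lookup f v in v∈f
... | false = disjoint⇒multiplicity≡0 v e v∈e ds
... | true  = contradiction (subst (1 ≤_) (≡ᵇ⇒≡ _ 0 d) (common-vertex⇒∣∩∣≥1 e f v v∈e v∈f)) λ ()

pairwiseDisjoint⇒multiplicity≤1 : ∀ {n} (v : Fin n) es → T (pairwiseDisjointᵇ es) → multiplicity v es ≤ 1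
pairwiseDisjoint⇒multiplicity≤1 v []       _ = z≤n
pairwiseDisjoint⇒multiplicity≤1 v (e ∷ es) h with d , ds ← Equivalence.to T-∧ h | lookup e v in v∈e
... | false = pairwiseDisjoint⇒multiplicity≤1 v es ds
... | true  = ≤-reflexive (cong suc (disjoint⇒multiplicity≡0 v e v∈e (all⁺ (disjointᵇ e) es d)))

perfect⇒multiplicity≡1 : ∀ {n} (es : List (Subset n)) → T (isPerfectMatchingᵇ es) → ∀ v → multiplicity v es ≡ 1
perfect⇒multiplicity≡1 {n} es h v with d , c ← Equivalence.to (T-∧ {pairwiseDisjointᵇ es}) h = ≤-antisym
  (pairwiseDisjoint⇒multiplicity≤1 v es d)
  (any⇒multiplicity≥1 v (any⁻ (λ e → lookup e v) es (All.lookup (all⁺ (λ v → any (λ e → lookup e v) es) (allFin n) c) (∈-allFin v))))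

power-form : ∀ d′ m n k M c a b → n ≡ m * suc d′ → M * (a ^ m) ^ d′ ≤ k ^ m * (b ^ m) ^ d′ →
             M ^ suc d′ * a ^ (d′ * n) * c ^ n ≤ (suc c * k) ^ n * b ^ (d′ * n)
power-form d′ m n k M c a b n≡md h = begin
  M ^ d * a ^ (d′ * n) * c ^ n
    ≡⟨ cong (λ x → M ^ d * x * c ^ n) (regroup a) ⟩
  M ^ d * ((a ^ m) ^ d′) ^ d * c ^ n
    ≡⟨ cong (_* c ^ n) (^-distribʳ-* d M ((a ^ m) ^ d′)) ⟨
  (M * (a ^ m) ^ d′) ^ d * c ^ n
    ≤⟨ *-mono-≤ (^-monoˡ-≤ d h) (^-monoˡ-≤ n (n≤1+n c)) ⟩
  (k ^ m * (b ^ m) ^ d′) ^ d * suc c ^ n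
    ≡⟨ cong (_* suc c ^ n) (^-distribʳ-* d (k ^ m) ((b ^ m) ^ d′)) ⟩
  (k ^ m) ^ d * ((b ^ m) ^ d′) ^ d * suc c ^ n
    ≡⟨ cong₂ (λ x y → x * y * suc c ^ n) (trans (^-*-assoc k m d) (cong (k ^_) (sym n≡md))) (sym (regroup b)) ⟩
  k ^ n * b ^ (d′ * n) * suc c ^ n
    ≡⟨ eq (k ^ n) (b ^ (d′ * n)) (suc c ^ n) ⟩
  suc c ^ n * k ^ n * b ^ (d′ * n)
    ≡⟨ cong (_* b ^ (d′ * n)) (^-distribʳ-* n (suc c) k) ⟨
  (suc c * k) ^ n * b ^ (d′ * n) ∎
  where
  open ≤-Reasoning
  d = suc d′
  eq : ∀ x y z → x * y * z ≡ z * x * y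
  eq = solve-∀
  exponents : ∀ m d′ d → m * d′ * d ≡ d′ * (m * d)
  exponents = solve-∀
  regroup : ∀ x → x ^ (d′ * n) ≡ ((x ^ m) ^ d′) ^ d
  regroup x = sym (trans (cong (_^ d) (^-*-assoc x m d′)) (trans (^-*-assoc x (m * d′) d)
    (cong (x ^_) (trans (exponents m d′ d) (cong (d′ *_) (sym n≡md))))))

-- The bound for a single hypergraph

module _ {n : ℕ} (H : Hypergraph n) (d″ : ℕ) (uniformH : Uniform (2 + d″) H) (k : ℕ) (regularH : Regular k H) where

  d′ = suc d″

  incidence : Fin (length (edges H)) → Fin n → Bool
  incidence i v = lookup (List.lookup (edges H) i) v

  uniform : ∀ i → ∑ (λ v → ι (incidence i v)) ≡ suc d′
  uniform i = trans (sym (∣∣≡∑ (List.lookup (edges H) i))) (All.lookup uniformH (∈-lookup i))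

  open Matchings incidence d′ uniform
  open PerfectMatchings incidence d′ uniform

  regular : ∀ v → ∑ (λ f → ι (incidence f v)) ≡ k
  regular v = trans (sym (length-filterᵇ (λ e → lookup e v) (edges H))) (regularH v)

  codeg≡∑ : ∀ u v → codeg H u v ≡ ∑ (λ f → ι (incidence f u) * ι (incidence f v))
  codeg≡∑ u v = trans (length-filterᵇ (λ e → lookup e u ∧ lookup e v) (edges H))
                      (∑-cong λ f → ι-∧ (incidence f u) (incidence f v))

  perfect : Vec Bool (length (edges H)) → Bool
  perfect s = isPerfectMatchingᵇ (select (edges H) s)

  perfect⇒cov≡1 : ∀ s → T (perfect s) → ∀ v → cov s v ≡ 1
  perfect⇒cov≡1 s h v = trans (multiplicity-select v (edges H) s) (perfect⇒multiplicity≡1 (select (edges H) s) h v)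

  M≡∑ˢ : M H ≡ ∑ˢ (ι ∘ perfect)
  M≡∑ˢ = count-allSelections (length (edges H)) perfect

  M≤ : ∀ m → n ≡ m * suc d′ → M H ≤ ∑ˢ (λ s → 𝟙 (matching? s full m))
  M≤ m n≡md = ≤-trans (≤-reflexive M≡∑ˢ) (∑ˢ-mono λ s → go s (perfect s) refl)
    where
    go : ∀ s b → perfect s ≡ b → ι b ≤ 𝟙 (matching? s full m)
    go s false _  = z≤n
    go s true  eq = ≤-reflexive (sym (𝟙-true (matching? s full m) (size≡ , cov≡1)))
      where
      cov≡1 = perfect⇒cov≡1 s (Equivalence.from T-≡ eq)
      size≡ : size s ≡ m
      size≡ = *-cancelʳ-≡ (size s) m (suc d′) (trans (sym (covering⇒n≡size*d s cov≡1)) n≡md)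

  M≢0⇒d∣n : M H ≢ 0 → ∃ λ m → n ≡ m * suc d′
  M≢0⇒d∣n M≢0 with s , ≢0 ← ∑ˢ-nonzero (ι ∘ perfect) (M≢0 ∘ trans M≡∑ˢ) =
    size s , covering⇒n≡size*d s (perfect⇒cov≡1 s (holds (perfect s) ≢0))
    where
    holds : ∀ b → ι b ≢ 0 → T b
    holds true  _  = _
    holds false ≢0 = contradiction refl ≢0

  hypergraph-bound : ∀ t .{{_ : NonZero t}} m₀ a b c → suc m₀ * suc d′ ≤ n →
    (∀ m → m₀ ≤ m → a ^ m * ∏ {m} (λ j → t * suc (toℕ j) + m) ≤ b ^ m * (m * t) ^ m) →
    (∀ u v → u ≢ v → t ^ d′ * (suc d′ * suc d′) * codeg H u v ≤ k) →
    M H ^ suc d′ * a ^ (d′ * n) * c ^ n ≤ (suc c * k) ^ n * b ^ (d′ * n)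
  hypergraph-bound t m₀ a b c n≥ shifted codeg≤ with M H ≟ 0
  -- Divisibility of n by d is not assumed: without a perfect matching the bound is trivial, and
  -- with one m = n/d is its size.
  ... | yes M≡0 = subst (λ x → x ^ suc d′ * a ^ (d′ * n) * c ^ n ≤ (suc c * k) ^ n * b ^ (d′ * n)) (sym M≡0) z≤n
  ... | no M≢0 with m , n≡md ← M≢0⇒d∣n M≢0 =
    power-form d′ m n k (M H) c a b n≡md (≤-trans (*-monoˡ-≤ ((a ^ m) ^ d′) (M≤ m n≡md))
      (Bound.count≤ k m t regular n≡md
        (λ u v u≢v → subst (λ x → t ^ d′ * (suc d′ * suc d′) * x ≤ k) (codeg≡∑ u v) (codeg≤ u v u≢v))
        a b (shifted m (≤-trans (n≤1+n m₀) m₀<m))))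
    where
    m₀<m : suc m₀ ≤ m
    -- The threshold is (m₀ + 1) d instead of m₀ d so that m is also nonzero.
    m₀<m = *-cancelʳ-≤ (suc m₀) m (suc d′) (subst (suc m₀ * suc d′ ≤_) n≡md n≥)
    instance
      m≢0 : NonZero m
      m≢0 = >-nonZero (≤-trans (s≤s z≤n) m₀<m)

-- The d-th power clears the exponent n/d. The limit is expressed by rationals: 1 + 1/c stands for 1
-- + o(1), and b/a for a number above 1/e.
theorem4 : (d : ℕ) → 2 ≤ d → (k : ℕ → ℕ) → (H : (n : ℕ) → Hypergraph n) →
    (∀ n → Uniform d (H n)) → (∀ n → Regular (k n) (H n)) →
    TendsToInfinity k → CodegreeLittleO H k →
    ∀ (c : ℕ) → 1 ≤ c → ∀ (a b : ℕ) → BelowE a b →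
    ∃ λ N → ∀ n → N ≤ n →
    M (H n) ^ d * a ^ ((d ∸ 1) * n) * c ^ n ≤ (suc c * k n) ^ n * b ^ ((d ∸ 1) * n)
theorem4 d@(suc (suc d″)) (s≤s (s≤s _)) k H uniform regular _ codegree c _ a b a<be =
  eventually (shifted-factorial-bound a b a<be)
  where
  eventually : (∃ λ t → 1 ≤ t × ∃ λ m₀ → ∀ m → m₀ ≤ m →
                 a ^ m * ∏ {m} (λ j → t * suc (toℕ j) + m) ≤ b ^ m * (m * t) ^ m) →
               ∃ λ N → ∀ n → N ≤ n →
                 M (H n) ^ d * a ^ ((d ∸ 1) * n) * c ^ n ≤ (suc c * k n) ^ n * b ^ ((d ∸ 1) * n)
  eventually (t , 1≤t , m₀ , shifted) = N + suc m₀ * d , λ n N≤n →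
    hypergraph-bound (H n) d″ (uniform n) (k n) (regular n) t m₀ a b c
      (m+n≤o⇒n≤o N N≤n) shifted (codeg≤ n (m+n≤o⇒m≤o N N≤n))
    where
    instance
      t≢0 : NonZero t
      t≢0 = >-nonZero 1≤t
    codegree-small : ∃ λ N → ∀ n → N ≤ n → ∀ u v → u ≢ v → t ^ suc d″ * (d * d) * codeg (H n) u v ≤ k n
    -- The d² offsets the pairs of vertices in an edge of the matching; t^(d-1) matches the shift by
    -- m/t raised to the power d - 1.
    codegree-small = codegree (t ^ suc d″ * (d * d)) (>-nonZero⁻¹ _ {{m*n≢0 (t ^ suc d″) (d * d) {{m^n≢0 t (suc d″)}}}})
    N = proj₁ codegree-small
    codeg≤ = proj₂ codegree-small
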